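{- Given any $\epsilon > 0$, any algorithm achieving a $(\frac{4}{3}-\epsilon)$-approximation for the Monotone Submodular $k$-Multiway Partitioning problem (Mon-Sub-$k$-MP) when $k$ is part of the input, requires exponentially many queries in the value oracle model.
   Context: For a finite set $V$, a function $f:2^V\to\mathbb{R}$ is submodular if $f(A\cup\{v\})-f(A)\ge f(B\cup\{v\})-f(B)$ for all $A\subseteq B\subseteq V$ and $v\notin B$; it is monotone if $f(A)\le f(B)$ whenever $A\subseteq B\subseteq V$. The symbol $\uplus$ denotes the union of disjoint sets and $[k]=\{1,\dots,k\}$. Mon-Sub-$k$-MP: given a non-negative monotone submodular function $f:2^V\to\mathbb{R}_+$ over a ground set $V$, partition $V$ into $k$ non-empty sets so as to attain $$\min \sum_{i=1}^k f(S_i)\quad\text{s.t. } S_1\uplus S_2\uplus\cdots\uplus S_k=V,\ S_i\neq\emptyset \text{ for all } i\in[k].$$ Value oracle model: $f$ is accessed through an oracle that returns $f(S)$ for a given set $S\subseteq V$. Hardness results in this model are information-theoretic: they are limits on the approximability of a problem when only polynomially many queries to the value oracle are allowed. An algorithm achieves an $\alpha$-approximation if it outputs a feasible $(S_1,\dots,S_k)$ with $\sum_i f(S_i)$ at most $\alpha$ times the optimal value. -}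

module Defs where

open import Level using (_⊔_) renaming (suc to lsuc)
open import Algebra.Apartness.Bundles using (HeytingField; HeytingCommutativeRing)
open import Algebra.Bundles using (CommutativeRing)
import Algebra.Definitions.RawMonoid as RawMonoidDefinitions
open import Data.Fin.Base using (Fin)
open import Data.Fin.Subset using (Subset; _∈_; _∉_; _⊆_; _∪_; _∩_; ⁅_⁆; Empty; Nonempty; ∣_∣)
open import Data.Nat.Base as ℕ using (ℕ; suc; NonZero)
open import Data.Product.Base using (Σ-syntax; ∃-syntax; _×_; proj₁)
open import Data.Sum.Base using (_⊎_; inj₂)
open import Relation.Binary.Core using (Rel)
open import Relation.Binary.Structures using (IsStrictPartialOrder)
open import Relation.Binary.PropositionalEquality using (_≡_; _≢_)
open import Relation.Nullary using (¬_)

-- The library has no real numbers, so values are taken in an arbitrary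
-- Archimedean ordered field.  The axioms are constructive: they hold for
-- ℚ, for the Cauchy and Dedekind reals and, classically, for every
-- Archimedean totally ordered field.
record ArchimedeanOrderedField c ℓ₁ ℓ₂ ℓ₃ : Set (lsuc (c ⊔ ℓ₁ ⊔ ℓ₂ ⊔ ℓ₃)) where
  infix 4 _<_ _≤_
  field
    heytingField : HeytingField c ℓ₁ ℓ₂

  open HeytingField heytingField public

  commutativeRing : CommutativeRing c ℓ₁
  commutativeRing =
    HeytingCommutativeRing.commutativeRing (HeytingField.heytingCommutativeRing heytingField)

  open RawMonoidDefinitions (CommutativeRing.+-rawMonoid commutativeRing) public
    using (sum) renaming (_×_ to _·_)

  fromℕ : ℕ → Carrier
  fromℕ n = n · 1#

  field
    _<_                  : Rel Carrier ℓ₃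
    isStrictPartialOrder : IsStrictPartialOrder _≈_ _<_
    #⇒<⊎>                : ∀ {x y} → x # y → x < y ⊎ y < x
    <⊎>⇒#                : ∀ {x y} → x < y ⊎ y < x → x # y
    0<1                  : 0# < 1#
    +-monoˡ-<            : ∀ z {x y} → x < y → x + z < y + z
    *-pos                : ∀ {x y} → 0# < x → 0# < y → 0# < x * y
    archimedean          : ∀ x → ∃[ n ] x < fromℕ n

  private module <-Order = IsStrictPartialOrder isStrictPartialOrder

  _≤_ : Rel Carrier ℓ₃
  x ≤ y = ¬ (y < x)

  x<1+x : ∀ x → x < 1# + x
  x<1+x x = <-Order.<-respˡ-≈ (+-identityˡ x) (+-monoˡ-< x 0<1)

  fromℕ-pos : ∀ n → 0# < fromℕ (suc n)
  fromℕ-pos ℕ.zero  = x<1+x 0#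
  fromℕ-pos (suc n) = <-Order.trans (fromℕ-pos n) (x<1+x (fromℕ (suc n)))

  -- The library's inverse of 3 is an inverse of 3 - 0.
  4/3 : Carrier
  4/3 = fromℕ 4 * proj₁ (#⇒invertible {fromℕ 3} {0#} (<⊎>⇒# (inj₂ (fromℕ-pos 2))))

module _ {c ℓ₁ ℓ₂ ℓ₃} (ℝ : ArchimedeanOrderedField c ℓ₁ ℓ₂ ℓ₃) where

  open ArchimedeanOrderedField ℝ

  SetFunction : ℕ → Set c
  SetFunction n = Subset n → Carrier

  NonNegative : ∀ {n} → SetFunction n → Set ℓ₃
  NonNegative f = ∀ A → 0# ≤ f A

  Monotone : ∀ {n} → SetFunction n → Set ℓ₃
  Monotone f = ∀ A B → A ⊆ B → f A ≤ f B

  Submodular : ∀ {n} → SetFunction n → Set ℓ₃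
  Submodular f = ∀ A B v → A ⊆ B → v ∉ B →
    f (B ∪ ⁅ v ⁆) - f B ≤ f (A ∪ ⁅ v ⁆) - f A

  record MonSub (n : ℕ) : Set (c ⊔ ℓ₃) where
    field
      f           : SetFunction n
      nonNegative : NonNegative f
      monotone    : Monotone f
      submodular  : Submodular f

  open MonSub using (f)

  record IsPartition {n k} (S : Fin k → Subset n) : Set where
    field
      disjoint : ∀ i j → i ≢ j → Empty (S i ∩ S j)
      covers   : ∀ v → ∃[ i ] v ∈ S i
      nonempty : ∀ i → Nonempty (S i)

  cost : ∀ {n k} → SetFunction n → (Fin k → Subset n) → Carrier
  cost f S = sum (λ i → f (S i))

  record IsOptimal {n k} (f : SetFunction n) (S : Fin k → Subset n) : Set ℓ₃ where
    field
      isPartition : IsPartition S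
      minimal     : ∀ (T : Fin k → Subset n) → IsPartition T → cost f S ≤ cost f T

  IsApproximation : ∀ {n k} → Carrier → SetFunction n → (Fin k → Subset n) → Set ℓ₃
  IsApproximation {n} {k} α f S =
    IsPartition S ×
    (∀ (T : Fin k → Subset n) → IsOptimal f T → cost f S ≤ α * cost f T)

  -- The model is information-theoretic: a deterministic algorithm for fixed n
  -- and k is an adaptive strategy of queries, and computation is free.
  data Strategy (n k : ℕ) : Set c where
    output : (Fin k → Subset n) → Strategy n k
    query  : Subset n → (Carrier → Strategy n k) → Strategy n k

  result : ∀ {n k} → Strategy n k → SetFunction n → Fin k → Subset n
  result (output S)     f = S
  result (query A next) f = result (next (f A)) f

  queries : ∀ {n k} → Strategy n k → SetFunction n → ℕ
  queries (output S)     f = 0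
  queries (query A next) f = suc (queries (next (f A)) f)

  -- The random seed is uniform on Fin seeds; deterministic algorithms are
  -- those with seeds = 1.
  record RandomizedStrategy (n k : ℕ) : Set c where
    field
      seeds             : ℕ
      .{{seedsNonZero}} : NonZero seeds
      strategy          : Fin seeds → Strategy n k

  open RandomizedStrategy using (seeds; strategy)

  -- The numbers n and k are part of the input.
  Algorithm : Set c
  Algorithm = ∀ n k → RandomizedStrategy n k

  -- On every feasible instance the output is an α-approximation with
  -- probability at least p.
  Achieves : Algorithm → Carrier → Carrier → Set (c ⊔ ℓ₃)
  Achieves 𝒜 α p = ∀ n k → 1 ℕ.≤ k → k ℕ.≤ n → (I : MonSub n) →
    Σ[ G ∈ Subset (seeds (𝒜 n k)) ]
      (p * fromℕ (seeds (𝒜 n k)) ≤ fromℕ ∣ G ∣) ×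
      (∀ s → s ∈ G → IsApproximation α (f I) (result (strategy (𝒜 n k) s) (f I)))

  -- Some instance on n elements and some seed lead to exactly q queries.
  MakesQueries : Algorithm → ℕ → ℕ → Set (c ⊔ ℓ₃)
  MakesQueries 𝒜 n q = ∃[ k ] 1 ℕ.≤ k × k ℕ.≤ n ×
    (Σ[ I ∈ MonSub n ] ∃[ s ] queries (strategy (𝒜 n k) s) (f I) ≡ q)

  -- The worst case is at least cⁿ queries for all large n, where c = 2^(1/d).
  ExponentiallyManyQueries : Algorithm → ℕ → ℕ → Set (c ⊔ ℓ₃)
  ExponentiallyManyQueries 𝒜 d n₀ = ∀ n → n₀ ℕ.≤ n →
    ∃[ q ] MakesQueries 𝒜 n q × 2 ℕ.^ n ℕ.≤ q ℕ.^ d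

{-# OPTIONS --safe #-}
module Submission where

-- Let n elements be given, k = ⌈n/2⌉ + 1 and m = ⌊n/2⌋.  For f₀(A) = min(m, |A|)
-- every partition into k parts costs n.  Planting a set R with |R| = m by
-- f_R(A) = min(m, |A ∖ R| + min(β, |A ∩ R|)), β slightly above n/4, makes
-- the partition into R and singletons cost about 3n/4.  A set A tells f_R from
-- f₀ only if |A ∩ R| exceeds |A ∖ R| by a linear amount, which by a Chernoff
-- bound happens for an exponentially small fraction of a suitable family of
-- sets R.  A strategy that is correct on this family with probability p has,
-- by averaging, a seed whose run on f₀ (queries and output) distinguishes a
-- fraction at least p of the family, so this run is exponentially long.

open import Defs
open import Algebra.Bundles using (CommutativeRing)
import Algebra.Properties.CommutativeMonoid.Sum as CommutativeMonoidSum
import Algebra.Properties.CommutativeSemigroup as CommutativeSemigroupProperties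
import Algebra.Properties.Ring as RingProperties
import Algebra.Properties.Semiring.Mult as SemiringMult
import Algebra.Properties.Semiring.Sum as SemiringSum
open import Data.Fin.Base using (Fin; zero; suc)
import Data.Fin.Properties as Fin
open import Data.Fin.Subset
  using (Subset; inside; outside; _∈_; _∉_; _⊆_; _∪_; _∩_; ∁; ⁅_⁆; ⊥; Nonempty; ∣_∣)
open import Data.Fin.Subset.Properties
  using (∪-identityʳ; ∩-zeroˡ; ∩-inverseʳ; ∣⊥∣≡0; ∉⊥; p⊆p∪q; p⊆q⇒∣p∣≤∣q∣; ∣p∩q∣≤∣p∣; x∈p∩q⁺; x∈p∩q⁻)
open import Data.List.Base using (List; []; _∷_; _++_; map; length; tabulate)
open import Data.List.Properties using (length-++; length-map; length-tabulate; map-++; map-∘)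
open import Data.List.Relation.Unary.All as All using (All; []; _∷_)
import Data.List.Relation.Unary.All.Properties as All
open import Data.Nat.Base as ℕ using (ℕ; zero; suc; _^_; ⌊_/2⌋; ⌈_/2⌉; z≤n; s≤s)
open import Data.Nat.DivMod using (m≡m%n+[m/n]*n; m%n<n; m/n*n≤m; m*n/n≡m; /-monoˡ-≤)
open import Data.Nat.ListAction using (sum)
open import Data.Nat.ListAction.Properties using (sum-++)
import Data.Nat.Properties as ℕ
open import Data.Nat.Tactic.RingSolver using (solve-∀)
open import Data.Product.Base using (∃-syntax; Σ-syntax; _×_; _,_; proj₁; proj₂)
open import Data.Sum.Base using (_⊎_; inj₁; inj₂)
open import Data.Vec.Base using ([]; _∷_; head; tail; here; there)
open import Function.Base using (_∘_)
open import Relation.Binary.PropositionalEquality as ≡ using (_≡_; _≢_)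
import Relation.Binary.Reasoning.Setoid as SetoidReasoning
open import Relation.Binary.Structures using (IsStrictPartialOrder)
open import Relation.Nullary using (¬_; Dec; yes; no; contradiction)

open CommutativeMonoidSum ℕ.+-0-commutativeMonoid
  using (∑-distrib-+; sum-cong-≗; sum-replicate-zero) renaming (sum to ∑)

-- The cap `β` is as small as secrecy allows. A set A that meets R and its complement in x elements
-- each can tell f_R from f₀ only if β < x and x + β < m, which forces 2β < m. With β = (m + t)/2
-- only sets unbalanced by at least `t` detect R, while the optimum drops from n to about n/4 + n/2:
-- this ratio is the 4/3. The margin `t` is, up to rounding, a fraction of n fixed by ε: small
-- enough to keep the ratio above 4/3 - ε, yet linear, so that large deviations are exponentially
-- rare. Adaptivity is harmless because a run whose answers all agree with f₀ is the run on f₀. Its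
-- list of sets does not depend on R, so a union bound over a fixed list applies. The output parts
-- join the list because their total cost is known to be at least n only when they are undetected
-- too. All estimates stay in ℕ with denominators cleared. The exponential tilt is the rational
-- number (d + 1)/d with `d` fixed by ε, so no logarithm enters, and the rate appears as a fixed
-- power of the number of queries.

module Combinatorics where

  open import Data.Nat.Base
  open import Data.Nat.Properties
  open import Relation.Binary.PropositionalEquality

  -- Inequalities for truncations, powers and exponentials in ℕ.

  -- Capping keeps a monotone submodular function submodular: read `p`, `q`, `p′`, `q′` as its
  -- values at A, B, A ∪ v, B ∪ v. Once `q` or `p′` reaches the cap, monotonicity suffices;
  -- otherwise the right side is uncapped. Both caps of `hidden` rely on this.
  ⊓-submodular : ∀ c {p q p′ q′} → p ≤ q → p ≤ p′ → q′ + p ≤ p′ + q →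
    (c ⊓ q′) + (c ⊓ p) ≤ (c ⊓ p′) + (c ⊓ q)
  ⊓-submodular c {p} {q} {p′} {q′} p≤q p≤p′ q′+p≤p′+q with ≤-total c q | ≤-total c p′
  ... | inj₁ c≤q | _ rewrite m≤n⇒m⊓n≡m c≤q =
    ≤-trans (+-mono-≤ (m⊓n≤m c q′) (⊓-monoʳ-≤ c p≤p′)) (≤-reflexive (+-comm c _))
  ... | inj₂ q≤c | inj₁ c≤p′ rewrite m≤n⇒m⊓n≡m c≤p′ =
    +-mono-≤ (m⊓n≤m c q′) (⊓-monoʳ-≤ c p≤q)
  ... | inj₂ q≤c | inj₂ p′≤c rewrite m≥n⇒m⊓n≡n q≤c | m≥n⇒m⊓n≡n p′≤c =
    ≤-trans (+-mono-≤ (m⊓n≤n c q′) (m⊓n≤n c p)) q′+p≤p′+q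

  -- Bernoulli's inequality (1 + 1/a)^k ≥ 1 + k/a, multiplied by a^(k+1).
  bernoulli : ∀ a k → a ^ k * (a + k) ≤ a * suc a ^ k
  bernoulli a zero    = ≤-reflexive (base a)
    where
    base : ∀ a → 1 * (a + 0) ≡ a * 1
    base = solve-∀
  bernoulli a (suc k) = begin
    a * a ^ k * (a + suc k)         ≤⟨ m≤m+n _ (k * a ^ k) ⟩
    a * a ^ k * (a + suc k) + k * a ^ k ≡⟨ step a k (a ^ k) ⟩
    suc a * (a ^ k * (a + k))       ≤⟨ *-monoʳ-≤ (suc a) (bernoulli a k) ⟩
    suc a * (a * suc a ^ k)         ≡⟨ swap (suc a) a (suc a ^ k) ⟩
    a * (suc a * suc a ^ k)         ∎
    where
    open ≤-Reasoning
    step : ∀ a k x → a * x * (a + suc k) + k * x ≡ suc a * (x * (a + k))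
    step = solve-∀
    swap : ∀ a b x → a * (b * x) ≡ b * (a * x)
    swap = solve-∀

  -- (1 + 1/c)^k ≤ c / (c − k), for c = r + k.
  reverse-bernoulli : ∀ c k r → r + k ≡ c → suc c ^ k * r ≤ c ^ k * c
  reverse-bernoulli c zero    r r+k≡c = *-monoʳ-≤ 1 (≤-reflexive (trans (sym (+-identityʳ r)) r+k≡c))
  reverse-bernoulli c (suc k) r r+k≡c = begin
    suc c * suc c ^ k * r       ≡⟨ pull (suc c) (suc c ^ k) r ⟩
    suc c ^ k * (r + c * r)
      ≤⟨ *-monoʳ-≤ (suc c ^ k) (+-monoˡ-≤ (c * r) (m+n≤o⇒m≤o r (≤-reflexive r+k≡c))) ⟩
    suc c ^ k * (c + c * r)     ≡⟨ push c (suc c ^ k) r ⟩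
    c * (suc c ^ k * suc r)
      ≤⟨ *-monoʳ-≤ c (reverse-bernoulli c k (suc r) (trans (sym (+-suc r k)) r+k≡c)) ⟩
    c * (c ^ k * c)             ≡⟨ *-assoc c (c ^ k) c ⟨
    c * c ^ k * c               ∎
    where
    open ≤-Reasoning
    pull : ∀ a x r → a * x * r ≡ x * (a * r)
    pull = solve-∀
    push : ∀ c x r → x * (c + c * r) ≡ c * (x * suc r)
    push = solve-∀

  1+n≤2^n : ∀ n → suc n ≤ 2 ^ n
  1+n≤2^n zero    = ≤-refl
  1+n≤2^n (suc n) = begin
    suc (suc n)         ≤⟨ s≤s (m≤n+m (suc n) n) ⟩
    suc (n + suc n)     ≡⟨ double n ⟩
    2 * suc n           ≤⟨ *-monoʳ-≤ 2 (1+n≤2^n n) ⟩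
    2 * 2 ^ n           ∎
    where
    open ≤-Reasoning
    double : ∀ n → suc (n + suc n) ≡ 2 * suc n
    double = solve-∀

  m<[1+m/n]*n : ∀ m n .{{_ : NonZero n}} → m < suc (m / n) * n
  m<[1+m/n]*n m n = begin-strict
    m                    ≡⟨ m≡m%n+[m/n]*n m n ⟩
    m % n + m / n * n    <⟨ +-monoˡ-< (m / n * n) (m%n<n m n) ⟩
    suc (m / n) * n      ∎
    where open ≤-Reasoning

  -- With k = 2e and q = n / k, the base c n is at most (c k)(q + 1), and each of these two factors
  -- is at most 2^q; the power e of their product is then at most 2^(q k) ≤ 2^n. The threshold c k k
  -- is what makes c k at most q.
  power≤exponential : ∀ c e .{{_ : NonZero e}} → ∃[ n₀ ] ∀ n → n₀ ≤ n → (c * n) ^ e ≤ 2 ^ n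
  power≤exponential c e@(suc _) = c * k * k , bound
    where
    open ≤-Reasoning
    k = 2 * e
    regroup : ∀ c k q → c * (q * k) ≡ (c * k) * q
    regroup = solve-∀
    exponent : ∀ e q → (q + q) * e ≡ q * (2 * e)
    exponent = solve-∀
    bound : ∀ n → c * k * k ≤ n → (c * n) ^ e ≤ 2 ^ n
    bound n n₀≤n = begin
      (c * n) ^ e                    ≤⟨ ^-monoˡ-≤ e (*-monoʳ-≤ c (<⇒≤ (m<[1+m/n]*n n k))) ⟩
      (c * (suc q * k)) ^ e          ≡⟨ cong (_^ e) (regroup c k (suc q)) ⟩
      (c * k * suc q) ^ e            ≤⟨ ^-monoˡ-≤ e (*-mono-≤ ck≤2^q (1+n≤2^n q)) ⟩
      (2 ^ q * 2 ^ q) ^ e            ≡⟨ cong (_^ e) (^-distribˡ-+-* 2 q q) ⟨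
      (2 ^ (q + q)) ^ e              ≡⟨ ^-*-assoc 2 (q + q) e ⟩
      2 ^ ((q + q) * e)              ≡⟨ cong (2 ^_) (exponent e q) ⟩
      2 ^ (q * k)                    ≤⟨ ^-monoʳ-≤ 2 (m/n*n≤m n k) ⟩
      2 ^ n                          ∎
      where
      q = n / k
      ck≤2^q : c * k ≤ 2 ^ q
      ck≤2^q =
        ≤-trans (≤-trans (≤-reflexive (sym (m*n/n≡m (c * k) k))) (/-monoˡ-≤ k n₀≤n))
          (≤-trans (n≤1+n q) (1+n≤2^n q))

  pigeonhole-∑ : ∀ k (h : Fin (suc k) → ℕ) c → suc k * c ≤ ∑ h → ∃[ i ] c ≤ h i
  pigeonhole-∑ zero    h c kc≤∑ =
    zero , subst₂ _≤_ (*-identityˡ c) (+-identityʳ (h zero)) kc≤∑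
  pigeonhole-∑ (suc k) h c kc≤∑ with c ≤? h zero
  ... | yes c≤h₀ = zero , c≤h₀
  ... | no  c≰h₀ with pigeonhole-∑ k (λ i → h (suc i)) c
                    (+-cancelˡ-≤ c _ _ (≤-trans kc≤∑ (+-monoˡ-≤ _ (<⇒≤ (≰⇒> c≰h₀)))))
  ...   | i , c≤hᵢ = suc i , c≤hᵢ

  ^-distribʳ-* : ∀ a b k → (a * b) ^ k ≡ a ^ k * b ^ k
  ^-distribʳ-* a b zero    = refl
  ^-distribʳ-* a b (suc k) = trans (cong (a * b *_) (^-distribʳ-* a b k)) (interchange a b (a ^ k) (b ^ k))
    where
    interchange : ∀ a b x y → a * b * (x * y) ≡ a * x * (b * y)
    interchange = solve-∀

  -- The moment-generating factor per pair is (u² + v²) / 2uv = 1 + 1/2uv for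
  -- u = d + 1, v = d; its m-th power is beaten by (u / v)^t as soon as m ≤ d t.
  chernoff : ∀ d .{{_ : NonZero d}} m t e b → m ≤ d * t →
    b * (d ^ m * suc d ^ (m + e) * suc d ^ t) ≤
      d ^ t * ((suc d * suc d + d * d) ^ m * suc d ^ e) →
    b * suc (2 * d) ^ t ≤ 2 ^ m * (2 * d) ^ t
  chernoff d@(suc _) m t e b m≤dt moment =
    *-cancelʳ-≤ _ _ w {{m*n≢0 _ _ {{m*n≢0 _ _ {{m^n≢0 d m}} {{m^n≢0 u (m + e)}}}} {{m^n≢0 u t}}}} (begin
      b * suc (2 * d) ^ t * w              ≡⟨ swap b (suc (2 * d) ^ t) w ⟩
      b * w * suc (2 * d) ^ t              ≤⟨ *-monoˡ-≤ (suc (2 * d) ^ t) moment ⟩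
      d ^ t * ((u * u + d * d) ^ m * u ^ e) * suc (2 * d) ^ t
        ≡⟨ cong (λ x → d ^ t * (x ^ m * u ^ e) * suc (2 * d) ^ t) (squares d) ⟩
      d ^ t * (suc c ^ m * u ^ e) * suc (2 * d) ^ t
        ≡⟨ regroup (d ^ t) (suc c ^ m) (u ^ e) (suc (2 * d) ^ t) ⟩
      suc c ^ m * (d ^ t * suc (2 * d) ^ t) * u ^ e
                                           ≤⟨ *-monoˡ-≤ (u ^ e) power-bound ⟩
      c ^ m * ((2 * d) ^ t * u ^ t) * u ^ e
                                           ≡⟨ cong (λ x → x * ((2 * d) ^ t * u ^ t) * u ^ e) c^m ⟩
      2 ^ m * (u ^ m * d ^ m) * ((2 * d) ^ t * u ^ t) * u ^ e
        ≡⟨ collect (2 ^ m) (u ^ m) (d ^ m) ((2 * d) ^ t) (u ^ t) (u ^ e) ⟩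
      2 ^ m * (2 * d) ^ t * (d ^ m * (u ^ m * u ^ e) * u ^ t)
        ≡⟨ cong (λ x → 2 ^ m * (2 * d) ^ t * (d ^ m * x * u ^ t)) (^-distribˡ-+-* u m e) ⟨
      2 ^ m * (2 * d) ^ t * w              ∎)
    where
    open ≤-Reasoning
    u = suc d
    c = 2 * (u * d)
    w = d ^ m * u ^ (m + e) * u ^ t
    swap : ∀ x y z → x * y * z ≡ x * z * y
    swap = solve-∀
    squares : ∀ d → suc d * suc d + d * d ≡ suc (2 * (suc d * d))
    squares = solve-∀
    regroup : ∀ x y z a → x * (y * z) * a ≡ y * (x * a) * z
    regroup = solve-∀
    collect : ∀ a x y z p q → a * (x * y) * (z * p) * q ≡ a * z * (y * (x * q) * p)
    collect = solve-∀
    c^m : c ^ m ≡ 2 ^ m * (u ^ m * d ^ m)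
    c^m = trans (^-distribʳ-* 2 (u * d) m) (cong (2 ^ m *_) (^-distribʳ-* u d m))
    -- A block of d factors 1 + 1/c is at most c / (c - d) = (u/d) · (2d / (2d + 1)). So one factor
    -- u/d of the tilt pays for a whole block and still leaves the saving 2d / (2d + 1).
    per-block : suc c ^ d * (d * suc (2 * d)) ≤ c ^ d * (2 * d * u)
    per-block = subst (λ x → suc c ^ d * (d * suc (2 * d)) ≤ c ^ d * x) (scale d)
      (reverse-bernoulli c d (d * suc (2 * d)) (split d))
      where
      scale : ∀ d → 2 * (suc d * d) ≡ 2 * d * suc d
      scale = solve-∀
      split : ∀ d → d * suc (2 * d) + d ≡ 2 * (suc d * d)
      split = solve-∀
    expand : ∀ x y z → (x ^ d * (y * z)) ^ t ≡ x ^ (d * t) * (y ^ t * z ^ t)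
    expand x y z = trans (^-distribʳ-* (x ^ d) (y * z) t)
      (cong₂ _*_ (^-*-assoc x d t) (^-distribʳ-* y z t))
    -- The m factors 1 + 1/c are padded by j more to fill exactly t blocks of length d.
    j = d * t ∸ m
    power-bound : suc c ^ m * (d ^ t * suc (2 * d) ^ t) ≤ c ^ m * ((2 * d) ^ t * u ^ t)
    power-bound = *-cancelˡ-≤ (c ^ j) {{m^n≢0 c j}} (begin
      c ^ j * (suc c ^ m * y)        ≡⟨ *-assoc (c ^ j) (suc c ^ m) y ⟨
      c ^ j * suc c ^ m * y          ≤⟨ *-monoˡ-≤ y (*-monoˡ-≤ (suc c ^ m) (^-monoˡ-≤ j (n≤1+n c))) ⟩
      suc c ^ j * suc c ^ m * y      ≡⟨ cong (_* y) (^-distribˡ-+-* (suc c) j m) ⟨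
      suc c ^ (j + m) * y            ≡⟨ cong (λ x → suc c ^ x * y) (m∸n+n≡m m≤dt) ⟩
      suc c ^ (d * t) * y            ≡⟨ expand (suc c) d (suc (2 * d)) ⟨
      (suc c ^ d * (d * suc (2 * d))) ^ t ≤⟨ ^-monoˡ-≤ t per-block ⟩
      (c ^ d * (2 * d * u)) ^ t      ≡⟨ expand c (2 * d) u ⟩
      c ^ (d * t) * z                ≡⟨ cong (λ x → c ^ x * z) (m∸n+n≡m m≤dt) ⟨
      c ^ (j + m) * z                ≡⟨ cong (_* z) (^-distribˡ-+-* c j m) ⟩
      c ^ j * c ^ m * z              ≡⟨ *-assoc (c ^ j) (c ^ m) z ⟩
      c ^ j * (c ^ m * z)            ∎)
      where
      y = d ^ t * suc (2 * d) ^ t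
      z = (2 * d) ^ t * u ^ t

  -- By Bernoulli (1 + 1/a)^a ≥ 2, so raising (1 + 1/a)^t ≤ x to the power a turns the base into 2.
  ratio-bound⇒2^t≤x^a : ∀ a .{{_ : NonZero a}} t x → suc a ^ t ≤ x * a ^ t → 2 ^ t ≤ x ^ a
  ratio-bound⇒2^t≤x^a a@(suc _) t x [1+a]^t≤xa^t =
    *-cancelʳ-≤ _ _ (a ^ (a * t)) {{m^n≢0 a (a * t)}} (begin
      2 ^ t * a ^ (a * t)      ≡⟨ cong (2 ^ t *_) (^-*-assoc a a t) ⟨
      2 ^ t * (a ^ a) ^ t      ≡⟨ ^-distribʳ-* 2 (a ^ a) t ⟨
      (2 * a ^ a) ^ t          ≤⟨ ^-monoˡ-≤ t doubling ⟩
      (suc a ^ a) ^ t          ≡⟨ ^-*-assoc (suc a) a t ⟩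
      suc a ^ (a * t)          ≡⟨ cong (suc a ^_) (*-comm a t) ⟩
      suc a ^ (t * a)          ≡⟨ ^-*-assoc (suc a) t a ⟨
      (suc a ^ t) ^ a          ≤⟨ ^-monoˡ-≤ a [1+a]^t≤xa^t ⟩
      (x * a ^ t) ^ a          ≡⟨ ^-distribʳ-* x (a ^ t) a ⟩
      x ^ a * (a ^ t) ^ a      ≡⟨ cong (x ^ a *_) (^-*-assoc a t a) ⟩
      x ^ a * a ^ (t * a)      ≡⟨ cong (λ y → x ^ a * a ^ y) (*-comm t a) ⟩
      x ^ a * a ^ (a * t)      ∎)
    where
    open ≤-Reasoning
    rearrange : ∀ a x → a * (2 * x) ≡ x * (a + a)
    rearrange = solve-∀
    doubling : 2 * a ^ a ≤ suc a ^ a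
    doubling = *-cancelˡ-≤ a (begin
      a * (2 * a ^ a)   ≡⟨ rearrange a (a ^ a) ⟩
      a ^ a * (a + a)   ≤⟨ bernoulli a a ⟩
      a * suc a ^ a     ∎)

  -- Squaring creates a spare factor 2^n. For positive q and n, q + n ≤ 2 q n, so the square is
  -- bounded by (2 p n)^(2e) times q^(2e), and the spare 2^n absorbs the polynomial factor. For q =
  -- 0 the same bound would give 4^n ≤ 2^n.
  exponential-in-n : ∀ d .{{_ : NonZero d}} p n .{{_ : NonZero n}} t q →
    n ≤ 3 * d * t → 2 ^ t ≤ (p * (q + n)) ^ (2 * d) →
    (2 * p * n) ^ (2 * (2 * d * (3 * d))) ≤ 2 ^ n →
    2 ^ n ≤ q ^ (2 * (2 * d * (3 * d)))
  exponential-in-n d p n t q n≤3dt 2^t≤ 2pn^2e≤ = cancel q square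
    where
    open ≤-Reasoning
    e = 2 * d * (3 * d)
    root : 2 ^ n ≤ (p * (q + n)) ^ e
    root = begin
      2 ^ n                                ≤⟨ ^-monoʳ-≤ 2 n≤3dt ⟩
      2 ^ (3 * d * t)                      ≡⟨ cong (2 ^_) (*-comm (3 * d) t) ⟩
      2 ^ (t * (3 * d))                    ≡⟨ ^-*-assoc 2 t (3 * d) ⟨
      (2 ^ t) ^ (3 * d)                    ≤⟨ ^-monoˡ-≤ (3 * d) 2^t≤ ⟩
      ((p * (q + n)) ^ (2 * d)) ^ (3 * d)  ≡⟨ ^-*-assoc (p * (q + n)) (2 * d) (3 * d) ⟩
      (p * (q + n)) ^ e                    ∎
    square : 2 ^ n * 2 ^ n ≤ (p * (q + n)) ^ (2 * e)
    square = begin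
      2 ^ n * 2 ^ n                          ≤⟨ *-mono-≤ root root ⟩
      (p * (q + n)) ^ e * (p * (q + n)) ^ e  ≡⟨ ^-distribˡ-+-* (p * (q + n)) e e ⟨
      (p * (q + n)) ^ (e + e)                ≡⟨ cong (λ x → (p * (q + n)) ^ (e + x)) (+-identityʳ e) ⟨
      (p * (q + n)) ^ (2 * e)                ∎
    cancel : ∀ q → 2 ^ n * 2 ^ n ≤ (p * (q + n)) ^ (2 * e) → 2 ^ n ≤ q ^ (2 * e)
    cancel zero 4^n≤ = contradiction (≤-trans (1+n≤2^n n) 2^n≤1) (<⇒≱ (s≤s (>-nonZero⁻¹ n)))
      where
      2^n≤1 : 2 ^ n ≤ 1
      2^n≤1 = *-cancelˡ-≤ (2 ^ n) {{m^n≢0 2 n}} (begin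
        2 ^ n * 2 ^ n          ≤⟨ 4^n≤ ⟩
        (p * n) ^ (2 * e)      ≤⟨ ^-monoˡ-≤ (2 * e) (*-monoˡ-≤ n (m≤m+n p _)) ⟩
        (2 * p * n) ^ (2 * e)  ≤⟨ 2pn^2e≤ ⟩
        2 ^ n                  ≡⟨ *-identityʳ (2 ^ n) ⟨
        2 ^ n * 1              ∎)
    cancel q@(suc _) 4^n≤ = *-cancelˡ-≤ (2 ^ n) {{m^n≢0 2 n}} (begin
      2 ^ n * 2 ^ n                      ≤⟨ 4^n≤ ⟩
      (p * (q + n)) ^ (2 * e)
        ≤⟨ ^-monoˡ-≤ (2 * e) (*-monoʳ-≤ p (+-mono-≤ (m≤m*n q n) (m≤n*m n q))) ⟩
      (p * (q * n + q * n)) ^ (2 * e)    ≡⟨ cong (_^ (2 * e)) (collect p q n) ⟩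
      (2 * p * n * q) ^ (2 * e)          ≡⟨ ^-distribʳ-* (2 * p * n) q (2 * e) ⟩
      (2 * p * n) ^ (2 * e) * q ^ (2 * e) ≤⟨ *-monoˡ-≤ (q ^ (2 * e)) 2pn^2e≤ ⟩
      2 ^ n * q ^ (2 * e)                ∎)
      where
      collect : ∀ p q n → p * (q * n + q * n) ≡ 2 * p * n * q
      collect = solve-∀

  -- Rounding, and the choice of `t` and `β`.

  n≤⌈n/2⌉+⌈n/2⌉ : ∀ n → n ≤ ⌈ n /2⌉ + ⌈ n /2⌉
  n≤⌈n/2⌉+⌈n/2⌉ n = ≤-trans (≤-reflexive (sym (⌊n/2⌋+⌈n/2⌉≡n n))) (+-monoˡ-≤ ⌈ n /2⌉ (⌊n/2⌋≤⌈n/2⌉ n))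

  ⌈n/2⌉+⌈n/2⌉≤1+n : ∀ n → ⌈ n /2⌉ + ⌈ n /2⌉ ≤ suc n
  ⌈n/2⌉+⌈n/2⌉≤1+n n =
    ≤-trans (+-monoʳ-≤ ⌈ n /2⌉ (⌊n/2⌋≤⌈n/2⌉ (suc n))) (≤-reflexive (⌊n/2⌋+⌈n/2⌉≡n (suc n)))

  ⌈n/2⌉≤1+⌊n/2⌋ : ∀ n → ⌈ n /2⌉ ≤ suc ⌊ n /2⌋
  ⌈n/2⌉≤1+⌊n/2⌋ n = +-cancelʳ-≤ ⌈ n /2⌉ _ _
    (≤-trans (⌈n/2⌉+⌈n/2⌉≤1+n n) (s≤s (≤-reflexive (sym (⌊n/2⌋+⌈n/2⌉≡n n)))))

  -- t is about n / 8(E + 1), and β is the midpoint of ⌊ n /2⌋ and t rounded up.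
  record Parameters (E n : ℕ) : Set where
    field
      t β         : ℕ
      0<β         : 0 < β
      β≤m         : β ≤ ⌊ n /2⌋
      m+t≤2β      : ⌊ n /2⌋ + t ≤ β + β
      m≤Dt        : ⌊ n /2⌋ ≤ 4 * suc E * t
      n≤3Dt       : n ≤ 3 * (4 * suc E) * t
      -- Equivalently (4/3 - 1/(E + 1)) b ≤ n, where b = β + ⌈n/2⌉ is the planted optimum.
      gap         : 4 * (suc E * (β + ⌈ n /2⌉)) ≤ 3 * (suc E * n) + 3 * (β + ⌈ n /2⌉)

  -- Up to rounding, 2β = m + t gives 8(E + 1)(β + c) = 6(E + 1)n + D t, which explains D = 4(E +
  -- 1): the excess D t is at most D + m. The assumption D ≤ m bounds this and the rounding errors
  -- together by 4m, well within the allowed 6(β + c).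
  parameters : ∀ E n → 4 * suc E ≤ ⌊ n /2⌋ → Parameters E n
  parameters E n D≤m = record
    { t = t ; β = β ; 0<β = subst (λ x → 0 < ⌈ x /2⌉) (sym (+-suc m (m / D))) z<s
      ; β≤m = β≤m ; m+t≤2β = n≤⌈n/2⌉+⌈n/2⌉ (m + t)
    ; m≤Dt = m≤Dt ; n≤3Dt = n≤3Dt ; gap = gap }
    where
    open ≤-Reasoning
    m = ⌊ n /2⌋
    c = ⌈ n /2⌉
    D = 4 * suc E
    t = suc (m / D)
    β = ⌈ m + t /2⌉
    b = β + c
    m≤Dt : m ≤ D * t
    m≤Dt = ≤-trans (<⇒≤ (m<[1+m/n]*n m D)) (≤-reflexive (*-comm t D))
    Dt≤D+m : D * t ≤ D + m
    Dt≤D+m = ≤-trans (≤-reflexive (*-comm D t)) (+-monoʳ-≤ D (m/n*n≤m m D))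
    t≤m : t ≤ m
    t≤m = *-cancelˡ-≤ 2 (begin
      2 * t     ≤⟨ *-monoˡ-≤ t (m≤m+n 2 2) ⟩
      4 * t     ≤⟨ *-monoˡ-≤ t (m≤m*n 4 (suc E)) ⟩
      D * t     ≤⟨ Dt≤D+m ⟩
      D + m     ≤⟨ +-monoˡ-≤ m D≤m ⟩
      m + m     ≡⟨ cong (m +_) (+-identityʳ m) ⟨
      2 * m     ∎)
    2β≤m+t+1 : β + β ≤ suc (m + t)
    2β≤m+t+1 = ⌈n/2⌉+⌈n/2⌉≤1+n (m + t)
    β≤m : β ≤ m
    β≤m = s≤s⁻¹ (*-cancelˡ-< 2 β (suc m) (begin-strict
      2 * β         ≡⟨ cong (β +_) (+-identityʳ β) ⟩
      β + β         ≤⟨ 2β≤m+t+1 ⟩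
      suc (m + t)   ≤⟨ s≤s (+-monoʳ-≤ m t≤m) ⟩
      suc (m + m)   <⟨ n<1+n _ ⟩
      2 + (m + m)   ≡⟨ double m ⟩
      2 * suc m     ∎))
      where
      double : ∀ m → 2 + (m + m) ≡ 2 * suc m
      double = solve-∀
    n≡m+c : m + c ≡ n
    n≡m+c = ⌊n/2⌋+⌈n/2⌉≡n n
    n≤3Dt : n ≤ 3 * D * t
    n≤3Dt = begin
      n               ≡⟨ n≡m+c ⟨
      m + c           ≤⟨ +-monoʳ-≤ m (⌈n/2⌉≤1+⌊n/2⌋ n) ⟩
      m + (1 + m)     ≤⟨ +-monoʳ-≤ m (+-monoˡ-≤ m (≤-trans (s≤s z≤n) D≤m)) ⟩
      m + (m + m)     ≡⟨ triple m ⟩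
      3 * m           ≤⟨ *-monoʳ-≤ 3 m≤Dt ⟩
      3 * (D * t)     ≡⟨ *-assoc 3 D t ⟨
      3 * D * t       ∎
      where
      triple : ∀ m → m + (m + m) ≡ 3 * m
      triple = solve-∀
    slack : D * 1 + D + D + m ≤ 6 * b
    slack = begin
      D * 1 + D + D + m
        ≤⟨ +-monoˡ-≤ m (+-mono-≤ (+-mono-≤ (≤-trans (≤-reflexive (*-identityʳ D)) D≤m) D≤m) D≤m) ⟩
      m + m + m + m      ≡⟨ quadruple m ⟩
      4 * m              ≤⟨ *-mono-≤ (m≤m+n 4 2) (≤-trans (⌊n/2⌋≤⌈n/2⌉ n) (m≤n+m c β)) ⟩
      6 * b              ∎
      where
      quadruple : ∀ m → m + m + m + m ≡ 4 * m
      quadruple = solve-∀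
    gap : 4 * (suc E * b) ≤ 3 * (suc E * n) + 3 * b
    gap = *-cancelˡ-≤ 2 (begin
      2 * (4 * (suc E * b))                      ≡⟨ expand (suc E) β c ⟩
      D * (β + β) + 6 * (suc E * c) + 2 * suc E * c
        ≤⟨ +-mono-≤ (+-monoˡ-≤ (6 * (suc E * c)) (*-monoʳ-≤ D 2β≤m+t+1))
             (*-monoʳ-≤ (2 * suc E) (⌈n/2⌉≤1+⌊n/2⌋ n)) ⟩
      D * suc (m + t) + 6 * (suc E * c) + 2 * suc E * suc m
        ≡⟨ regroup (suc E) m t c ⟩
      6 * (suc E * (m + c)) + (4 * suc E + 2 * suc E + D * t)
        ≤⟨ +-monoʳ-≤ (6 * (suc E * (m + c)))
             (+-mono-≤ (+-mono-≤ (≤-reflexive (sym (*-identityʳ D))) (*-monoˡ-≤ (suc E) (m≤m+n 2 2))) Dt≤D+m) ⟩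
      6 * (suc E * (m + c)) + (D * 1 + D + (D + m))
        ≤⟨ +-monoʳ-≤ (6 * (suc E * (m + c))) (≤-trans (≤-reflexive (sym (+-assoc (D * 1 + D) D m))) slack) ⟩
      6 * (suc E * (m + c)) + 6 * b              ≡⟨ cong (λ x → 6 * (suc E * x) + 6 * b) n≡m+c ⟩
      6 * (suc E * n) + 6 * b                    ≡⟨ halve (suc E * n) b ⟩
      2 * (3 * (suc E * n) + 3 * b)              ∎)
      where
      expand : ∀ e β c → 2 * (4 * (e * (β + c))) ≡ 4 * e * (β + β) + 6 * (e * c) + 2 * e * c
      expand = solve-∀
      regroup : ∀ e m t c → 4 * e * suc (m + t) + 6 * (e * c) + 2 * e * suc m
        ≡ 6 * (e * (m + c)) + (4 * e + 2 * e + 4 * e * t)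
      regroup = solve-∀
      halve : ∀ x b → 6 * x + 6 * b ≡ 2 * (3 * x + 3 * b)
      halve = solve-∀

  -- Finite sums, cardinalities and coverings.

  ∑-mono : ∀ {k} {g h : Fin k → ℕ} → (∀ i → g i ≤ h i) → ∑ g ≤ ∑ h
  ∑-mono {zero}  g≤h = z≤n
  ∑-mono {suc k} g≤h = +-mono-≤ (g≤h zero) (∑-mono (λ i → g≤h (suc i)))

  k≤∑ : ∀ {k} (h : Fin k → ℕ) → (∀ i → 0 < h i) → k ≤ ∑ h
  k≤∑ {zero}  h 0<h = z≤n
  k≤∑ {suc k} h 0<h = +-mono-≤ (0<h zero) (k≤∑ (λ i → h (suc i)) (λ i → 0<h (suc i)))

  ∑≤k : ∀ {k} (h : Fin k → ℕ) → (∀ i → h i ≤ 1) → ∑ h ≤ k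
  ∑≤k {zero}  h h≤1 = z≤n
  ∑≤k {suc k} h h≤1 = +-mono-≤ (h≤1 zero) (∑≤k (λ i → h (suc i)) (λ i → h≤1 (suc i)))

  hᵢ+k≤∑ : ∀ {k} (h : Fin (suc k) → ℕ) → (∀ i → 0 < h i) → ∀ i → h i + k ≤ ∑ h
  hᵢ+k≤∑ h 0<h zero = +-monoʳ-≤ (h zero) (k≤∑ (λ i → h (suc i)) (λ i → 0<h (suc i)))
  hᵢ+k≤∑ {suc k} h 0<h (suc i) = ≤-trans (≤-reflexive (+-suc (h (suc i)) k))
    (+-mono-≤ (0<h zero) (hᵢ+k≤∑ (λ i → h (suc i)) (λ i → 0<h (suc i)) i))

  hᵢ≤∑ : ∀ {k} (h : Fin k → ℕ) i → h i ≤ ∑ h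
  hᵢ≤∑ h zero    = m≤m+n (h zero) _
  hᵢ≤∑ h (suc i) = ≤-trans (hᵢ≤∑ (λ i → h (suc i)) i) (m≤n+m _ (h zero))

  ∣p∩q∣+∣p∩∁q∣≡∣p∣ : ∀ {n} (p q : Subset n) → ∣ p ∩ q ∣ + ∣ p ∩ ∁ q ∣ ≡ ∣ p ∣
  ∣p∩q∣+∣p∩∁q∣≡∣p∣ []            []            = refl
  ∣p∩q∣+∣p∩∁q∣≡∣p∣ (inside  ∷ p) (inside  ∷ q) = cong suc (∣p∩q∣+∣p∩∁q∣≡∣p∣ p q)
  ∣p∩q∣+∣p∩∁q∣≡∣p∣ (inside  ∷ p) (outside ∷ q) = trans (+-suc _ _) (cong suc (∣p∩q∣+∣p∩∁q∣≡∣p∣ p q))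
  ∣p∩q∣+∣p∩∁q∣≡∣p∣ (outside ∷ p) (_       ∷ q) = ∣p∩q∣+∣p∩∁q∣≡∣p∣ p q

  ∣∷∣ : ∀ {n} (p : Subset (suc n)) → ∣ p ∣ ≡ ∣ head p ∷ [] ∣ + ∣ tail p ∣
  ∣∷∣ (inside  ∷ p) = refl
  ∣∷∣ (outside ∷ p) = refl

  ∣[p∪⁅x⁆]∩q∣ : ∀ {n} {x : Fin n} (p q : Subset n) → x ∉ p →
    ∣ (p ∪ ⁅ x ⁆) ∩ q ∣ ≡ ∣ ⁅ x ⁆ ∩ q ∣ + ∣ p ∩ q ∣
  ∣[p∪⁅x⁆]∩q∣ {x = zero} (inside  ∷ p) _ x∉p = contradiction here x∉p
  ∣[p∪⁅x⁆]∩q∣ {suc n} {zero} (outside ∷ p) (inside ∷ q) _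
    rewrite ∪-identityʳ p | ∩-zeroˡ q | ∣⊥∣≡0 n = refl
  ∣[p∪⁅x⁆]∩q∣ {suc n} {zero} (outside ∷ p) (outside ∷ q) _
    rewrite ∪-identityʳ p | ∩-zeroˡ q | ∣⊥∣≡0 n = refl
  ∣[p∪⁅x⁆]∩q∣ {x = suc x} (inside  ∷ p) (inside  ∷ q) x∉p =
    trans (cong suc (∣[p∪⁅x⁆]∩q∣ p q (λ x∈p → x∉p (there x∈p)))) (sym (+-suc _ _))
  ∣[p∪⁅x⁆]∩q∣ {x = suc x} (inside  ∷ p) (outside ∷ q) x∉p =
    ∣[p∪⁅x⁆]∩q∣ p q (λ x∈p → x∉p (there x∈p))
  ∣[p∪⁅x⁆]∩q∣ {x = suc x} (outside ∷ p) (_       ∷ q) x∉p =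
    ∣[p∪⁅x⁆]∩q∣ p q (λ x∈p → x∉p (there x∈p))

  p⊆q⇒∣p∩r∣≤∣q∩r∣ : ∀ {n} {p q : Subset n} r → p ⊆ q → ∣ p ∩ r ∣ ≤ ∣ q ∩ r ∣
  p⊆q⇒∣p∩r∣≤∣q∩r∣ {p = p} {q} r p⊆q = p⊆q⇒∣p∣≤∣q∣ λ x∈p∩r →
    let x∈p , x∈r = x∈p∩q⁻ p r x∈p∩r in x∈p∩q⁺ (p⊆q x∈p , x∈r)

  Nonempty⇒0<∣p∣ : ∀ {n} (p : Subset n) → Nonempty p → 0 < ∣ p ∣
  Nonempty⇒0<∣p∣ (inside  ∷ p) _                 = z<s
  Nonempty⇒0<∣p∣ (outside ∷ p) (suc x , there x∈p) = Nonempty⇒0<∣p∣ p (x , x∈p)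

  0<∣p∣⇒Nonempty : ∀ {n} (p : Subset n) → 0 < ∣ p ∣ → Nonempty p
  0<∣p∣⇒Nonempty (inside  ∷ p) _     = zero , here
  0<∣p∣⇒Nonempty (outside ∷ p) 0<∣p∣ with 0<∣p∣⇒Nonempty p 0<∣p∣
  ... | x , x∈p = suc x , there x∈p

  -- Double counting by elements: the induction deletes one element of the ground set from all parts
  -- at once, and that element lies in some part.
  n≤∑∣Sᵢ∣ : ∀ {n k} (S : Fin k → Subset n) → (∀ v → ∃[ i ] v ∈ S i) → n ≤ ∑ (λ i → ∣ S i ∣)
  n≤∑∣Sᵢ∣ {zero}  S covers = z≤n
  n≤∑∣Sᵢ∣ {suc n} S covers = begin
    1 + n
      ≤⟨ +-mono-≤ head-covered (n≤∑∣Sᵢ∣ (λ i → tail (S i)) tail-covered) ⟩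
    ∑ (λ i → ∣ head (S i) ∷ [] ∣) + ∑ (λ i → ∣ tail (S i) ∣)
        ≡⟨ ∑-distrib-+ (λ i → ∣ head (S i) ∷ [] ∣) (λ i → ∣ tail (S i) ∣) ⟨
    ∑ (λ i → ∣ head (S i) ∷ [] ∣ + ∣ tail (S i) ∣)
                                              ≡⟨ sum-cong-≗ (λ i → ∣∷∣ (S i)) ⟨
    ∑ (λ i → ∣ S i ∣)                         ∎
    where
    open ≤-Reasoning
    zero∈⇒ : ∀ {n} {p : Subset (suc n)} → zero ∈ p → ∣ head p ∷ [] ∣ ≡ 1
    zero∈⇒ here = refl
    suc∈⇒ : ∀ {n} {p : Subset (suc n)} {v} → suc v ∈ p → v ∈ tail p
    suc∈⇒ (there v∈p) = v∈p
    head-covered : 1 ≤ ∑ (λ i → ∣ head (S i) ∷ [] ∣)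
    head-covered with covers zero
    ... | i , 0∈Sᵢ = ≤-trans (≤-reflexive (sym (zero∈⇒ 0∈Sᵢ))) (hᵢ≤∑ (λ i → ∣ head (S i) ∷ [] ∣) i)
    tail-covered : ∀ v → ∃[ i ] v ∈ tail (S i)
    tail-covered v with covers (suc v)
    ... | i , v∈Sᵢ = i , suc∈⇒ v∈Sᵢ

  -- The planted functions and the cost of partitions under them.

  -- For β < m the set R costs only β instead of m; for β = m every set costs
  -- min(m , |A|) and R leaves no trace.
  hidden : ∀ {n} → ℕ → ℕ → Subset n → Subset n → ℕ
  hidden m β R A = m ⊓ (∣ A ∩ ∁ R ∣ + (β ⊓ ∣ A ∩ R ∣))

  module _ {n} (m β : ℕ) (R : Subset n) where

    private
      inner : Subset n → ℕ
      inner A = ∣ A ∩ ∁ R ∣ + (β ⊓ ∣ A ∩ R ∣)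

      inner-mono : ∀ {A B} → A ⊆ B → inner A ≤ inner B
      inner-mono A⊆B =
        +-mono-≤ (p⊆q⇒∣p∩r∣≤∣q∩r∣ (∁ R) A⊆B) (⊓-monoʳ-≤ β (p⊆q⇒∣p∩r∣≤∣q∩r∣ R A⊆B))

      interchange : ∀ a b c d → (a + b) + (c + d) ≡ (a + c) + (b + d)
      interchange = solve-∀

      -- A modular term plus a capped modular term. In the proof `i` and `j` record whether `v` lies
      -- in R or outside; the modular term gives equality, and `⊓-submodular` handles the capped
      -- one.
      inner-submodular : ∀ {A B v} → A ⊆ B → v ∉ B →
        inner (B ∪ ⁅ v ⁆) + inner A ≤ inner (A ∪ ⁅ v ⁆) + inner B
      inner-submodular {A} {B} {v} A⊆B v∉B
        rewrite ∣[p∪⁅x⁆]∩q∣ B R v∉B | ∣[p∪⁅x⁆]∩q∣ B (∁ R) v∉B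
              | ∣[p∪⁅x⁆]∩q∣ A R (λ v∈A → v∉B (A⊆B v∈A))
              | ∣[p∪⁅x⁆]∩q∣ A (∁ R) (λ v∈A → v∉B (A⊆B v∈A)) = begin
        (j + yB + (β ⊓ (i + xB))) + (yA + (β ⊓ xA))
          ≡⟨ interchange (j + yB) (β ⊓ (i + xB)) yA (β ⊓ xA) ⟩
        (j + yB + yA) + ((β ⊓ (i + xB)) + (β ⊓ xA))
          ≤⟨ +-mono-≤ (≤-reflexive (swap j yB yA))
               (⊓-submodular β (p⊆q⇒∣p∩r∣≤∣q∩r∣ R A⊆B) (m≤n+m xA i) (≤-reflexive (swap i xB xA))) ⟩
        (j + yA + yB) + ((β ⊓ (i + xA)) + (β ⊓ xB))
          ≡⟨ interchange (j + yA) yB (β ⊓ (i + xA)) (β ⊓ xB) ⟩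
        (j + yA + (β ⊓ (i + xA))) + (yB + (β ⊓ xB)) ∎
        where
        open ≤-Reasoning
        i = ∣ ⁅ v ⁆ ∩ R ∣
        j = ∣ ⁅ v ⁆ ∩ ∁ R ∣
        xA = ∣ A ∩ R ∣
        xB = ∣ B ∩ R ∣
        yA = ∣ A ∩ ∁ R ∣
        yB = ∣ B ∩ ∁ R ∣
        swap : ∀ a b c → a + b + c ≡ a + c + b
        swap = solve-∀

    hidden-mono : ∀ {A B} → A ⊆ B → hidden m β R A ≤ hidden m β R B
    hidden-mono A⊆B = ⊓-monoʳ-≤ m (inner-mono A⊆B)

    hidden-submodular : ∀ {A B v} → A ⊆ B → v ∉ B →
      hidden m β R (B ∪ ⁅ v ⁆) + hidden m β R A ≤ hidden m β R (A ∪ ⁅ v ⁆) + hidden m β R B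
    hidden-submodular {A} {B} {v} A⊆B v∉B =
      ⊓-submodular m (inner-mono A⊆B) (inner-mono (p⊆p∪q {p = A} ⁅ v ⁆)) (inner-submodular A⊆B v∉B)

    hidden-pos : 0 < β → β ≤ m → ∀ {A} → Nonempty A → 0 < hidden m β R A
    hidden-pos 0<β β≤m {A} A≠∅ = ⊓-glb (≤-trans 0<β β≤m) inner-pos
      where
      inner-pos : 0 < inner A
      inner-pos with ∣ A ∩ R ∣ | ∣p∩q∣+∣p∩∁q∣≡∣p∣ A R
      ... | zero  | ∣A∩∁R∣≡∣A∣ =
        ≤-trans (≤-trans (Nonempty⇒0<∣p∣ A A≠∅) (≤-reflexive (sym ∣A∩∁R∣≡∣A∣))) (m≤m+n _ _)
      ... | suc x | _          = ≤-trans (⊓-glb 0<β z<s) (m≤n+m _ _)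

    -- Below β neither cap can be active: the outer one would give m ≥ β, and the inner one
    -- contributes β by itself.
    hidden<β⇒≡∣A∣ : β ≤ m → ∀ A → hidden m β R A < β → hidden m β R A ≡ ∣ A ∣
    hidden<β⇒≡∣A∣ β≤m A h<β with ≤-total m (inner A)
    ... | inj₁ m≤inner rewrite m≤n⇒m⊓n≡m m≤inner = contradiction h<β (≤⇒≯ β≤m)
    ... | inj₂ inner≤m rewrite m≥n⇒m⊓n≡n inner≤m with ≤-total β ∣ A ∩ R ∣
    ...   | inj₁ β≤x rewrite m≤n⇒m⊓n≡m β≤x = contradiction h<β (≤⇒≯ (m≤n+m β _))
    ...   | inj₂ x≤β rewrite m≥n⇒m⊓n≡n x≤β = trans (+-comm _ ∣ A ∩ R ∣) (∣p∩q∣+∣p∩∁q∣≡∣p∣ A R)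

    -- Either some part already costs β, or every part costs its cardinality.
    partition-cost : ∀ {c} → 0 < β → β ≤ m → β + c ≤ n → (S : Fin (suc c) → Subset n) →
      (∀ v → ∃[ i ] v ∈ S i) → (∀ i → Nonempty (S i)) → β + c ≤ ∑ (λ i → hidden m β R (S i))
    partition-cost {c} 0<β β≤m β+c≤n S covers nonempty with Fin.any? (λ i → β ≤? hidden m β R (S i))
    ... | yes (i , β≤hᵢ) = ≤-trans (+-monoˡ-≤ c β≤hᵢ)
      (hᵢ+k≤∑ (λ i → hidden m β R (S i)) (λ i → hidden-pos 0<β β≤m (nonempty i)) i)
    ... | no ¬∃ = ≤-trans β+c≤n (≤-trans (n≤∑∣Sᵢ∣ S covers)
      (≤-reflexive (sum-cong-≗ λ i → sym (hidden<β⇒≡∣A∣ β≤m (S i) (≰⇒> λ β≤hᵢ → ¬∃ (i , β≤hᵢ))))))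

  hidden-m : ∀ {n} m (R A : Subset n) → hidden m m R A ≡ m ⊓ ∣ A ∣
  hidden-m m R A with ≤-total m ∣ A ∩ R ∣
  ... | inj₁ m≤x rewrite m≤n⇒m⊓n≡m m≤x =
    trans (m≤n⇒m⊓n≡m (m≤n+m m _)) (sym (m≤n⇒m⊓n≡m (≤-trans m≤x (∣p∩q∣≤∣p∣ A R))))
  ... | inj₂ x≤m rewrite m≥n⇒m⊓n≡n x≤m =
    cong (m ⊓_) (trans (+-comm _ ∣ A ∩ R ∣) (∣p∩q∣+∣p∩∁q∣≡∣p∣ A R))

  -- Two situations hide R: |A ∩ R| ≤ β, where the inner cap is idle, and |A ∖ R| + β ≥ m, where
  -- both functions equal m. What remains gives |A ∖ R| ≤ m - β ≤ β - t and |A ∩ R| ≥ β.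
  detects⇒unbalanced : ∀ {n} m β t (R A : Subset n) → m + t ≤ β + β →
    hidden m β R A ≢ m ⊓ ∣ A ∣ → ∣ A ∩ ∁ R ∣ + t ≤ ∣ A ∩ R ∣
  detects⇒unbalanced m β t R A m+t≤2β h≢ with ≤-total β ∣ A ∩ R ∣ | ≤-total m (∣ A ∩ ∁ R ∣ + β)
  ... | inj₂ x≤β | _ rewrite m≥n⇒m⊓n≡n x≤β =
    contradiction (cong (m ⊓_) (trans (+-comm _ ∣ A ∩ R ∣) (∣p∩q∣+∣p∩∁q∣≡∣p∣ A R))) h≢
  ... | inj₁ β≤x | inj₁ m≤y+β rewrite m≤n⇒m⊓n≡m β≤x =
    contradiction (trans (m≤n⇒m⊓n≡m m≤y+β) (sym (m≤n⇒m⊓n≡m m≤∣A∣))) h≢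
    where
    m≤∣A∣ : m ≤ ∣ A ∣
    m≤∣A∣ = ≤-trans m≤y+β (≤-trans (+-monoʳ-≤ _ β≤x)
      (≤-reflexive (trans (+-comm _ ∣ A ∩ R ∣) (∣p∩q∣+∣p∩∁q∣≡∣p∣ A R))))
  ... | inj₁ β≤x | inj₂ y+β≤m = ≤-trans (+-cancelˡ-≤ β _ _ (begin
      β + (∣ A ∩ ∁ R ∣ + t)   ≡⟨ regroup β ∣ A ∩ ∁ R ∣ t ⟩
      ∣ A ∩ ∁ R ∣ + β + t     ≤⟨ +-monoˡ-≤ t y+β≤m ⟩
      m + t                   ≤⟨ m+t≤2β ⟩
      β + β                   ∎)) β≤x
    where
    open ≤-Reasoning
    regroup : ∀ a b c → a + (b + c) ≡ b + a + c
    regroup = solve-∀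

  -- The optimal partition: R together with singletons.

  -- Lists the elements outside R in increasing order. The index type shrinks by computation along
  -- the recursion on R, so no transport between `Fin` types is needed.
  singletons : ∀ {n} (R : Subset n) → Fin ∣ ∁ R ∣ → Subset n
  singletons (inside  ∷ R) i       = outside ∷ singletons R i
  singletons (outside ∷ R) zero    = inside ∷ ⊥
  singletons (outside ∷ R) (suc i) = outside ∷ singletons R i

  ∣singletons∣≡1 : ∀ {n} (R : Subset n) i → ∣ singletons R i ∣ ≡ 1
  ∣singletons∣≡1 (inside  ∷ R) i       = ∣singletons∣≡1 R i
  ∣singletons∣≡1 {suc n} (outside ∷ R) zero = cong suc (∣⊥∣≡0 n)
  ∣singletons∣≡1 (outside ∷ R) (suc i) = ∣singletons∣≡1 R i

  singletons-nonempty : ∀ {n} (R : Subset n) i → Nonempty (singletons R i)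
  singletons-nonempty (inside  ∷ R) i with singletons-nonempty R i
  ... | v , v∈ = suc v , there v∈
  singletons-nonempty (outside ∷ R) zero = zero , here
  singletons-nonempty (outside ∷ R) (suc i) with singletons-nonempty R i
  ... | v , v∈ = suc v , there v∈

  singletons-disjoint : ∀ {n} (R : Subset n) {v} i j →
    v ∈ singletons R i → v ∈ singletons R j → i ≡ j
  singletons-disjoint (inside  ∷ R) i j (there v∈i) (there v∈j) = singletons-disjoint R i j v∈i v∈j
  singletons-disjoint (outside ∷ R) zero    zero    _ _ = refl
  singletons-disjoint (outside ∷ R) zero    (suc j) (there v∈⊥) (there _) = contradiction v∈⊥ ∉⊥
  singletons-disjoint (outside ∷ R) (suc i) zero    (there _) (there v∈⊥) = contradiction v∈⊥ ∉⊥
  singletons-disjoint (outside ∷ R) (suc i) (suc j) (there v∈i) (there v∈j) =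
    cong suc (singletons-disjoint R i j v∈i v∈j)

  singletons-∉ : ∀ {n} (R : Subset n) {v} i → v ∈ R → v ∉ singletons R i
  singletons-∉ (inside  ∷ R) i       (there v∈R) (there v∈i) = singletons-∉ R i v∈R v∈i
  singletons-∉ (outside ∷ R) zero    (there v∈R) (there v∈⊥) = ∉⊥ v∈⊥
  singletons-∉ (outside ∷ R) (suc i) (there v∈R) (there v∈i) = singletons-∉ R i v∈R v∈i

  singletons-cover : ∀ {n} (R : Subset n) v → v ∈ R ⊎ ∃[ i ] v ∈ singletons R i
  singletons-cover (inside  ∷ R) zero = inj₁ here
  singletons-cover (outside ∷ R) zero = inj₂ (zero , here)
  singletons-cover (s ∷ R) (suc v) with singletons-cover R v
  singletons-cover (s       ∷ R) (suc v) | inj₁ v∈R       = inj₁ (there v∈R)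
  singletons-cover (inside  ∷ R) (suc v) | inj₂ (i , v∈i) = inj₂ (i , there v∈i)
  singletons-cover (outside ∷ R) (suc v) | inj₂ (i , v∈i) = inj₂ (suc i , there v∈i)

  hidden-partition : ∀ {n} (R : Subset n) → Fin (suc ∣ ∁ R ∣) → Subset n
  hidden-partition R zero    = R
  hidden-partition R (suc i) = singletons R i

  hidden-partition-cost : ∀ {n} m β (R : Subset n) →
    ∑ (λ i → hidden m β R (hidden-partition R i)) ≤ β + ∣ ∁ R ∣
  hidden-partition-cost {n} m β R = +-mono-≤ hidden-R≤β (∑≤k _ hidden-singleton≤1)
    where
    open ≤-Reasoning
    hidden-R≤β : hidden m β R R ≤ β
    hidden-R≤β = begin
      m ⊓ (∣ R ∩ ∁ R ∣ + (β ⊓ ∣ R ∩ R ∣))  ≤⟨ m⊓n≤n m _ ⟩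
      ∣ R ∩ ∁ R ∣ + (β ⊓ ∣ R ∩ R ∣)        ≡⟨ cong (λ p → ∣ p ∣ + (β ⊓ ∣ R ∩ R ∣)) (∩-inverseʳ R) ⟩
      ∣ ⊥ {n} ∣ + (β ⊓ ∣ R ∩ R ∣)              ≡⟨ cong (_+ (β ⊓ ∣ R ∩ R ∣)) (∣⊥∣≡0 n) ⟩
      β ⊓ ∣ R ∩ R ∣                        ≤⟨ m⊓n≤m β _ ⟩
      β                                    ∎
    hidden-singleton≤1 : ∀ i → hidden m β R (singletons R i) ≤ 1
    hidden-singleton≤1 i = begin
      hidden m β R (singletons R i)        ≤⟨ m⊓n≤n m _ ⟩
      ∣ singletons R i ∩ ∁ R ∣ + (β ⊓ ∣ singletons R i ∩ R ∣)
                                           ≤⟨ +-monoʳ-≤ _ (m⊓n≤n β _) ⟩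
      ∣ singletons R i ∩ ∁ R ∣ + ∣ singletons R i ∩ R ∣
                                           ≡⟨ +-comm _ ∣ singletons R i ∩ R ∣ ⟩
      ∣ singletons R i ∩ R ∣ + ∣ singletons R i ∩ ∁ R ∣
                                           ≡⟨ ∣p∩q∣+∣p∩∁q∣≡∣p∣ (singletons R i) R ⟩
      ∣ singletons R i ∣                   ≡⟨ ∣singletons∣≡1 R i ⟩
      1                                    ∎

  -- Sums over lists, and the family of planted sets.

  module _ {a} {X : Set a} where

    sum-map-mono : ∀ {f g : X → ℕ} {xs} → All (λ x → f x ≤ g x) xs → sum (map f xs) ≤ sum (map g xs)
    sum-map-mono []              = z≤n
    sum-map-mono (fx≤gx ∷ fxs≤gxs) = +-mono-≤ fx≤gx (sum-map-mono fxs≤gxs)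

    sum-map-*ʳ : ∀ (f : X → ℕ) c xs → sum (map (λ x → f x * c) xs) ≡ sum (map f xs) * c
    sum-map-*ʳ f c []       = refl
    sum-map-*ʳ f c (x ∷ xs) =
      trans (cong (f x * c +_) (sum-map-*ʳ f c xs)) (sym (*-distribʳ-+ c (f x) (sum (map f xs))))

    sum-map-const : ∀ c (xs : List X) → sum (map (λ _ → c) xs) ≡ length xs * c
    sum-map-const c []       = refl
    sum-map-const c (x ∷ xs) = cong (c +_) (sum-map-const c xs)

    sum-map-∑ : ∀ {k} (f : X → Fin k → ℕ) xs →
      sum (map (λ x → ∑ (f x)) xs) ≡ ∑ (λ i → sum (map (λ x → f x i) xs))
    sum-map-∑ {k} f []       = sym (sum-replicate-zero k)
    sum-map-∑ f (x ∷ xs) = trans (cong (∑ (f x) +_) (sum-map-∑ f xs))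
      (sym (∑-distrib-+ (f x) (λ i → sum (map (λ y → f y i) xs))))

    sum-map-+ : ∀ (f g : X → ℕ) xs → sum (map (λ x → f x + g x) xs) ≡ sum (map f xs) + sum (map g xs)
    sum-map-+ f g []       = refl
    sum-map-+ f g (x ∷ xs) = trans (cong (f x + g x +_) (sum-map-+ f g xs))
      (interchange (f x) (g x) (sum (map f xs)) (sum (map g xs)))
      where
      interchange : ∀ a b c d → (a + b) + (c + d) ≡ (a + c) + (b + d)
      interchange = solve-∀

    sum-map-swap : ∀ {b} {Y : Set b} (f : X → Y → ℕ) xs ys →
      sum (map (λ x → sum (map (f x) ys)) xs) ≡ sum (map (λ y → sum (map (λ x → f x y) xs)) ys)
    sum-map-swap f xs []       = trans (sum-map-const 0 xs) (*-zeroʳ (length xs))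
    sum-map-swap f xs (y ∷ ys) = trans (sum-map-+ (λ x → f x y) (λ x → sum (map (f x) ys)) xs)
      (cong (sum (map (λ x → f x y) xs) +_) (sum-map-swap f xs ys))

    sum-map≡0⇒≡0 : ∀ (f : X → ℕ) xs → sum (map f xs) ≡ 0 → All (λ x → f x ≡ 0) xs
    sum-map≡0⇒≡0 f []       _    = []
    sum-map≡0⇒≡0 f (x ∷ xs) ∑≡0 = m+n≡0⇒m≡0 (f x) ∑≡0 ∷ sum-map≡0⇒≡0 f xs (m+n≡0⇒n≡0 (f x) ∑≡0)

  -- The sets containing exactly one element of each pair {2i, 2i+1} (and not
  -- the last element when n is odd).  A uniformly random one of them has
  -- independent coordinates, so a Chernoff bound applies.
  transversals : ∀ n → List (Subset n)
  transversals zero          = [] ∷ []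
  transversals (suc zero)    = (outside ∷ []) ∷ []
  transversals (suc (suc n)) =
    map (λ R → inside ∷ outside ∷ R) (transversals n) ++
    map (λ R → outside ∷ inside ∷ R) (transversals n)

  length-transversals : ∀ n → length (transversals n) ≡ 2 ^ ⌊ n /2⌋
  length-transversals zero          = refl
  length-transversals (suc zero)    = refl
  length-transversals (suc (suc n)) = trans (length-++ (map _ (transversals n))) (cong₂ _+_
    (trans (length-map _ (transversals n)) (length-transversals n))
    (trans (length-map _ (transversals n)) (trans (length-transversals n) (sym (+-identityʳ _)))))

  Halving : ∀ {n} → Subset n → Set
  Halving {n} R = ∣ R ∣ ≡ ⌊ n /2⌋ × ∣ ∁ R ∣ ≡ ⌈ n /2⌉

  transversals-halving : ∀ n → All Halving (transversals n)
  transversals-halving zero          = (refl , refl) ∷ []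
  transversals-halving (suc zero)    = (refl , refl) ∷ []
  transversals-halving (suc (suc n)) = All.++⁺ (All.map⁺ extend) (All.map⁺ extend)
    where
    extend : All (λ R → suc ∣ R ∣ ≡ suc ⌊ n /2⌋ × suc ∣ ∁ R ∣ ≡ suc ⌈ n /2⌉) (transversals n)
    extend = All.map (λ (∣R∣ , ∣∁R∣) → cong suc ∣R∣ , cong suc ∣∁R∣) (transversals-halving n)

  -- Exponential moments over the transversals.

  module Weight (u v : ℕ) where

    -- One factor `u` per coordinate where A and R agree and one `v` where they differ. As a ratio
    -- this is (u/v)^(|A ∩ R| - |A ∖ R|) times v^|R| u^|∁R|. Weighting the coordinates outside A as
    -- well makes the normalising factor the same for all transversals.
    weight : ∀ {n} → Subset n → Subset n → ℕ
    weight []            []            = 1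
    weight (inside  ∷ A) (inside  ∷ R) = u * weight A R
    weight (inside  ∷ A) (outside ∷ R) = v * weight A R
    weight (outside ∷ A) (inside  ∷ R) = v * weight A R
    weight (outside ∷ A) (outside ∷ R) = u * weight A R

    weight-formula : ∀ {n} (A R : Subset n) →
      weight A R * (v ^ ∣ A ∩ R ∣ * u ^ ∣ A ∩ ∁ R ∣) ≡
      v ^ ∣ R ∣ * u ^ ∣ ∁ R ∣ * (u ^ ∣ A ∩ R ∣ * v ^ ∣ A ∩ ∁ R ∣)
    weight-formula []            []            = refl
    weight-formula (inside  ∷ A) (inside  ∷ R) =
      step u v (weight A R) (v ^ ∣ A ∩ R ∣) _ (v ^ ∣ R ∣) _ (u ^ ∣ A ∩ R ∣) _ (weight-formula A R)
      where
      rearrangeˡ : ∀ u v w x y → u * w * (v * x * y) ≡ u * v * (w * (x * y))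
      rearrangeˡ = solve-∀
      rearrangeʳ : ∀ u v a b p q → v * a * b * (u * p * q) ≡ u * v * (a * b * (p * q))
      rearrangeʳ = solve-∀
      step : ∀ u v w x y a b p q → w * (x * y) ≡ a * b * (p * q) →
        u * w * (v * x * y) ≡ v * a * b * (u * p * q)
      step u v w x y a b p q eq = trans (rearrangeˡ u v w x y)
        (trans (cong (u * v *_) eq) (sym (rearrangeʳ u v a b p q)))
    weight-formula (inside  ∷ A) (outside ∷ R) =
      step u v (weight A R) (v ^ ∣ A ∩ R ∣) _ (v ^ ∣ R ∣) _ (u ^ ∣ A ∩ R ∣) _ (weight-formula A R)
      where
      rearrangeˡ : ∀ u v w x y → v * w * (x * (u * y)) ≡ u * v * (w * (x * y))
      rearrangeˡ = solve-∀
      rearrangeʳ : ∀ u v a b p q → a * (u * b) * (p * (v * q)) ≡ u * v * (a * b * (p * q))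
      rearrangeʳ = solve-∀
      step : ∀ u v w x y a b p q → w * (x * y) ≡ a * b * (p * q) →
        v * w * (x * (u * y)) ≡ a * (u * b) * (p * (v * q))
      step u v w x y a b p q eq = trans (rearrangeˡ u v w x y)
        (trans (cong (u * v *_) eq) (sym (rearrangeʳ u v a b p q)))
    weight-formula (outside ∷ A) (inside  ∷ R) =
      trans (*-assoc v (weight A R) _) (trans (cong (v *_) (weight-formula A R))
        (rearrange v (v ^ ∣ R ∣) (u ^ ∣ ∁ R ∣) _))
      where
      rearrange : ∀ v a b p → v * (a * b * p) ≡ v * a * b * p
      rearrange = solve-∀
    weight-formula (outside ∷ A) (outside ∷ R) =
      trans (*-assoc u (weight A R) _) (trans (cong (u *_) (weight-formula A R))
        (rearrange u (v ^ ∣ R ∣) (u ^ ∣ ∁ R ∣) _))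
      where
      rearrange : ∀ u a b p → u * (a * b * p) ≡ a * (u * b) * p
      rearrange = solve-∀

    -- The threshold for Markov's inequality. The surplus `z` of |A ∩ R| over |A ∖ R| + t only
    -- helps, because u^z ≥ v^z.
    unbalanced⇒heavy : .{{_ : NonZero u}} .{{_ : NonZero v}} → v ≤ u → ∀ {n} (A R : Subset n) t →
      ∣ A ∩ ∁ R ∣ + t ≤ ∣ A ∩ R ∣ → v ^ ∣ R ∣ * u ^ ∣ ∁ R ∣ * u ^ t ≤ weight A R * v ^ t
    unbalanced⇒heavy v≤u A R t y+t≤x with ∣ A ∩ ∁ R ∣ | ∣ A ∩ R ∣ | m≤n⇒∃[o]m+o≡n y+t≤x | weight-formula A R
    ... | y | .(y + t + z) | z , refl | formula = *-cancelʳ-≤ _ _ (v ^ y * v ^ z * u ^ y)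
        {{m*n≢0 _ _ {{m*n≢0 _ _ {{m^n≢0 v y}} {{m^n≢0 v z}}}} {{m^n≢0 u y}}}} (begin
      c * u ^ t * (v ^ y * v ^ z * u ^ y)       ≡⟨ regroup₁ c (u ^ t) (v ^ y) (v ^ z) (u ^ y) ⟩
      c * (u ^ y * u ^ t * v ^ y) * v ^ z
        ≤⟨ *-monoʳ-≤ (c * (u ^ y * u ^ t * v ^ y)) (^-monoˡ-≤ z v≤u) ⟩
      c * (u ^ y * u ^ t * v ^ y) * u ^ z       ≡⟨ regroup₂ c (u ^ y) (u ^ t) (v ^ y) (u ^ z) ⟩
      c * (u ^ y * u ^ t * u ^ z * v ^ y)       ≡⟨ cong (λ x → c * (x * v ^ y)) (split u) ⟨
      c * (u ^ (y + t + z) * v ^ y)             ≡⟨ formula ⟨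
      weight A R * (v ^ (y + t + z) * u ^ y)    ≡⟨ cong (λ x → weight A R * (x * u ^ y)) (split v) ⟩
      weight A R * (v ^ y * v ^ t * v ^ z * u ^ y)
        ≡⟨ regroup₃ (weight A R) (v ^ y) (v ^ t) (v ^ z) (u ^ y) ⟩
      weight A R * v ^ t * (v ^ y * v ^ z * u ^ y) ∎)
      where
      open ≤-Reasoning
      c = v ^ ∣ R ∣ * u ^ ∣ ∁ R ∣
      split : ∀ w → w ^ (y + t + z) ≡ w ^ y * w ^ t * w ^ z
      split w = trans (^-distribˡ-+-* w (y + t) z) (cong (_* w ^ z) (^-distribˡ-+-* w y t))
      regroup₁ : ∀ c p q r s → c * p * (q * r * s) ≡ c * (s * p * q) * r
      regroup₁ = solve-∀
      regroup₂ : ∀ c p q r s → c * (p * q * r) * s ≡ c * (p * q * s * r)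
      regroup₂ = solve-∀
      regroup₃ : ∀ c p q r s → c * (p * q * r * s) ≡ c * q * (p * r * s)
      regroup₃ = solve-∀

    2uv≤u²+v² : 2 * (u * v) ≤ u * u + v * v
    2uv≤u²+v² with ≤-total u v
    ... | inj₁ u≤v with m≤n⇒∃[o]m+o≡n u≤v
    ...   | o , refl = ≤-trans (m≤m+n _ (o * o)) (≤-reflexive (square u o))
      where
      square : ∀ u o → 2 * (u * (u + o)) + o * o ≡ u * u + (u + o) * (u + o)
      square = solve-∀
    2uv≤u²+v² | inj₂ v≤u with m≤n⇒∃[o]m+o≡n v≤u
    ...   | o , refl = ≤-trans (m≤m+n _ (o * o)) (≤-reflexive (square v o))
      where
      square : ∀ v o → 2 * ((v + o) * v) + o * o ≡ (v + o) * (v + o) + v * v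
      square = solve-∀

    -- The sum factorises over the pairs: a pair contributes u² + v² if A contains exactly one of
    -- its elements and 2uv otherwise. For odd n the unpaired last element lies outside every
    -- transversal and contributes at most `u`, whence the last exponent, which is 0 or 1.
    sum-weight : v ≤ u → ∀ {n} (A : Subset n) →
      sum (map (weight A) (transversals n)) ≤ (u * u + v * v) ^ ⌊ n /2⌋ * u ^ (⌈ n /2⌉ ∸ ⌊ n /2⌋)
    sum-weight v≤u []             = ≤-refl
    sum-weight v≤u (inside  ∷ []) = ≤-trans (≤-reflexive (simplify v)) (≤-trans v≤u (≤-reflexive (simplify′ u)))
      where
      simplify : ∀ v → v * 1 + 0 ≡ v
      simplify = solve-∀
      simplify′ : ∀ u → u ≡ 1 * (u * 1)
      simplify′ = solve-∀
    sum-weight v≤u (outside ∷ []) = ≤-reflexive (simplify u)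
      where
      simplify : ∀ u → u * 1 + 0 ≡ 1 * (u * 1)
      simplify = solve-∀
    sum-weight v≤u {suc (suc n)} (a ∷ b ∷ A) = begin
      sum (map (weight (a ∷ b ∷ A)) (transversals (2 + n)))
        ≡⟨ cong sum (map-++ (weight (a ∷ b ∷ A)) (map io (transversals n)) (map oi (transversals n))) ⟩
      sum (map (weight (a ∷ b ∷ A)) (map io (transversals n)) ++ map (weight (a ∷ b ∷ A)) (map oi (transversals n)))
        ≡⟨ cong₂ (λ xs ys → sum (xs ++ ys)) (map-∘ (transversals n)) (map-∘ (transversals n)) ⟨
      sum (map (weight (a ∷ b ∷ A) ∘ io) (transversals n) ++ map (weight (a ∷ b ∷ A) ∘ oi) (transversals n))
        ≡⟨ sum-++ (map (weight (a ∷ b ∷ A) ∘ io) (transversals n)) _ ⟩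
      sum (map (weight (a ∷ b ∷ A) ∘ io) (transversals n)) + sum (map (weight (a ∷ b ∷ A) ∘ oi) (transversals n))
        ≡⟨ sum-map-+ (weight (a ∷ b ∷ A) ∘ io) (weight (a ∷ b ∷ A) ∘ oi) (transversals n) ⟨
      sum (map (λ R → weight (a ∷ b ∷ A) (io R) + weight (a ∷ b ∷ A) (oi R)) (transversals n))
        ≤⟨ sum-map-mono (All.universal (pair a b) (transversals n)) ⟩
      sum (map (λ R → weight A R * s) (transversals n))
        ≡⟨ sum-map-*ʳ (weight A) s (transversals n) ⟩
      sum (map (weight A) (transversals n)) * s
        ≤⟨ *-monoˡ-≤ s (sum-weight v≤u A) ⟩
      s ^ ⌊ n /2⌋ * u ^ (⌈ n /2⌉ ∸ ⌊ n /2⌋) * s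
        ≡⟨ regroup (s ^ ⌊ n /2⌋) _ s ⟩
      s * s ^ ⌊ n /2⌋ * u ^ (⌈ n /2⌉ ∸ ⌊ n /2⌋) ∎
      where
      open ≤-Reasoning
      s = u * u + v * v
      io oi : Subset n → Subset (2 + n)
      io R = inside ∷ outside ∷ R
      oi R = outside ∷ inside ∷ R
      regroup : ∀ x y s → x * y * s ≡ s * x * y
      regroup = solve-∀
      same : ∀ u v w → u * (v * w) + v * (u * w) ≡ 2 * (u * v) * w
      same = solve-∀
      opposite : ∀ u v w → u * (u * w) + v * (v * w) ≡ w * (u * u + v * v)
      opposite = solve-∀
      same≤ : ∀ w → 2 * (u * v) * w ≤ w * s
      same≤ w = ≤-trans (*-monoˡ-≤ w 2uv≤u²+v²) (≤-reflexive (*-comm s w))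
      -- The two coordinates of a pair cancel unless A contains exactly one of them.
      pair : ∀ a b R → weight (a ∷ b ∷ A) (io R) + weight (a ∷ b ∷ A) (oi R) ≤ weight A R * s
      pair inside  inside  R = ≤-trans (≤-reflexive (same u v (weight A R))) (same≤ (weight A R))
      pair inside  outside R = ≤-reflexive (opposite u v (weight A R))
      pair outside inside  R =
        ≤-reflexive (trans (+-comm (v * (v * weight A R)) _) (opposite u v (weight A R)))
      pair outside outside R = ≤-trans
        (≤-reflexive (trans (+-comm (v * (u * weight A R)) _) (same u v (weight A R))))
        (same≤ (weight A R))

  -- Counting the planted sets that given queries detect.

  refuted : ∀ {p} {P : Set p} → Dec P → ℕ
  refuted (yes _) = 0
  refuted (no  _) = 1

  detection : ∀ {n} → ℕ → ℕ → Subset n → Subset n → ℕ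
  detection m β R A = refuted (hidden m β R A ≟ hidden m m ⊥ A)

  detection≡0⇒≡ : ∀ {n} m β (R A : Subset n) → detection m β R A ≡ 0 → hidden m β R A ≡ hidden m m ⊥ A
  detection≡0⇒≡ m β R A d≡0 with hidden m β R A ≟ hidden m m ⊥ A
  ... | yes h≡h = h≡h

  module _ {n} (d : ℕ) .{{_ : NonZero d}} (β t : ℕ)
    (m+t≤2β : ⌊ n /2⌋ + t ≤ β + β) (m≤dt : ⌊ n /2⌋ ≤ d * t)
    (A : Subset n) where

    private
      m = ⌊ n /2⌋
      e = ⌈ n /2⌉ ∸ ⌊ n /2⌋
      u = suc d
      k = d ^ m * u ^ (m + e) * u ^ t
      open Weight u d

      detection≤weight : ∀ {R} → Halving R → detection m β R A * k ≤ weight A R * d ^ t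
      detection≤weight {R} (∣R∣≡m , ∣∁R∣≡⌈n/2⌉) with hidden m β R A ≟ hidden m m ⊥ A
      ... | yes _  = z≤n
      ... | no h≢h = begin
        1 * k                                 ≡⟨ *-identityˡ k ⟩
        d ^ m * u ^ (m + e) * u ^ t
          ≡⟨ cong₂ (λ x y → d ^ x * u ^ y * u ^ t) ∣R∣≡m (trans ∣∁R∣≡⌈n/2⌉ (sym (m+[n∸m]≡n (⌊n/2⌋≤⌈n/2⌉ n)))) ⟨
        d ^ ∣ R ∣ * u ^ ∣ ∁ R ∣ * u ^ t       ≤⟨ unbalanced⇒heavy (n≤1+n d) A R t
                                                   (detects⇒unbalanced m β t R A m+t≤2β
                                                     (λ h≡m → h≢h (trans h≡m (sym (hidden-m m ⊥ A))))) ⟩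
        weight A R * d ^ t                    ∎
        where open ≤-Reasoning

    -- Markov's inequality: each detecting R has weight at least k / d^t, and `sum-weight` bounds
    -- the total weight. `chernoff` then leaves at most a fraction (2d / (2d + 1))^t of the
    -- transversals.
    few-detections :
      sum (map (λ R → detection m β R A) (transversals n)) * suc (2 * d) ^ t ≤ 2 ^ m * (2 * d) ^ t
    few-detections = chernoff d m t e (sum (map (λ R → detection m β R A) (transversals n))) m≤dt (begin
      sum (map (λ R → detection m β R A) (transversals n)) * k
        ≡⟨ sum-map-*ʳ (λ R → detection m β R A) k (transversals n) ⟨
      sum (map (λ R → detection m β R A * k) (transversals n))
        ≤⟨ sum-map-mono (All.map detection≤weight (transversals-halving n)) ⟩
      sum (map (λ R → weight A R * d ^ t) (transversals n))
        ≡⟨ sum-map-*ʳ (weight A) (d ^ t) (transversals n) ⟩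
      sum (map (weight A) (transversals n)) * d ^ t
        ≤⟨ *-monoˡ-≤ (d ^ t) (sum-weight (n≤1+n d) A) ⟩
      (u * u + d * d) ^ m * u ^ e * d ^ t                       ≡⟨ *-comm _ (d ^ t) ⟩
      d ^ t * ((u * u + d * d) ^ m * u ^ e)                     ∎)
      where open ≤-Reasoning

  ∣p∣≤∑ : ∀ {n} (p : Subset n) (h : Fin n → ℕ) → (∀ x → x ∈ p → 0 < h x) → ∣ p ∣ ≤ ∑ h
  ∣p∣≤∑ []            h 0<h = z≤n
  ∣p∣≤∑ (inside  ∷ p) h 0<h =
    +-mono-≤ (0<h zero here) (∣p∣≤∑ p (λ x → h (suc x)) (λ x x∈p → 0<h (suc x) (there x∈p)))
  ∣p∣≤∑ (outside ∷ p) h 0<h =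
    ≤-trans (∣p∣≤∑ p (λ x → h (suc x)) (λ x x∈p → 0<h (suc x) (there x∈p))) (m≤n+m _ (h zero))

  detections : ∀ {n} → ℕ → List (Subset n) → Subset n → ℕ
  detections {n} β As R = sum (map (detection ⌊ n /2⌋ β R) As)

  -- Count the detecting pairs of a transversal and a list entry. There are at least 2^m / P of
  -- them, while each entry accounts for at most 2^m (2d / (2d + 1))^t. Hence (1 + 1/(2d))^t ≤ P
  -- |As|, and `ratio-bound⇒2^t≤x^a` applies with a = 2d.
  detecting-needs-many-sets : ∀ {n} d .{{_ : NonZero d}} β t P (As : List (Subset n)) →
    ⌊ n /2⌋ + t ≤ β + β → ⌊ n /2⌋ ≤ d * t →
    2 ^ ⌊ n /2⌋ ≤ sum (map (detections β As) (transversals n)) * P →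
    2 ^ t ≤ (P * length As) ^ (2 * d)
  detecting-needs-many-sets {n} d@(suc _) β t P As m+t≤2β m≤dt many =
    ratio-bound⇒2^t≤x^a (2 * d) t (P * length As)
      (*-cancelˡ-≤ (2 ^ m) {{m^n≢0 2 m}} (begin
        2 ^ m * a                                   ≤⟨ *-monoˡ-≤ a many ⟩
        total * P * a                             ≡⟨ regroup₁ total P a ⟩
        P * (total * a)
          ≡⟨ cong (λ x → P * (x * a)) (sum-map-swap (λ R A → detection m β R A) (transversals n) As) ⟩
        P * (sum (map detecting As) * a)          ≡⟨ cong (P *_) (sum-map-*ʳ detecting a As) ⟨
        P * sum (map (λ A → detecting A * a) As)
          ≤⟨ *-monoʳ-≤ P (sum-map-mono (All.universal (few-detections d β t m+t≤2β m≤dt) As)) ⟩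
        P * sum (map (λ _ → 2 ^ m * b) As)        ≡⟨ cong (P *_) (sum-map-const (2 ^ m * b) As) ⟩
        P * (length As * (2 ^ m * b))           ≡⟨ regroup₂ P (length As) (2 ^ m) b ⟩
        2 ^ m * (P * length As * b)             ∎))
    where
    open ≤-Reasoning
    m = ⌊ n /2⌋
    a = suc (2 * d) ^ t
    b = (2 * d) ^ t
    total = sum (map (detections β As) (transversals n))
    detecting : Subset n → ℕ
    detecting A = sum (map (λ R → detection m β R A) (transversals n))
    regroup₁ : ∀ x p a → x * p * a ≡ p * (x * a)
    regroup₁ = solve-∀
    regroup₂ : ∀ p l m b → p * (l * (m * b)) ≡ m * (p * l * b)
    regroup₂ = solve-∀

-- Arithmetic in the ordered field and its comparison with ℕ.

module OrderedFieldProperties {c ℓ₁ ℓ₂ ℓ₃} (ℝ : ArchimedeanOrderedField c ℓ₁ ℓ₂ ℓ₃) where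

  open ArchimedeanOrderedField ℝ hiding (zero) renaming (sum to ∑ᶠ)
  open CommutativeRing commutativeRing using (semiring; ring; *-commutativeSemigroup)
  open RingProperties ring using (-‿distribʳ-*)
  open SemiringMult semiring using (×-homo-+; ×1-homo-*)
  open CommutativeSemigroupProperties *-commutativeSemigroup
    using (x∙yz≈y∙xz; x∙yz≈xz∙y)
  open SetoidReasoning setoid
  open IsStrictPartialOrder isStrictPartialOrder public
    using (<-respˡ-≈; <-respʳ-≈)
    renaming (irrefl to <-irrefl; trans to <-trans; asym to <-asym)

  x-y+y≈x : ∀ x y → x - y + y ≈ x
  x-y+y≈x x y = trans (+-assoc x (- y) y) (trans (+-congˡ (-‿inverseˡ y)) (+-identityʳ x))

  x+y-y≈x : ∀ x y → x + y - y ≈ x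
  x+y-y≈x x y = trans (+-assoc x y (- y)) (trans (+-congˡ (-‿inverseʳ y)) (+-identityʳ x))

  +-monoʳ-< : ∀ z {x y} → x < y → z + x < z + y
  +-monoʳ-< z {x} {y} x<y =
    <-respˡ-≈ (+-comm x z) (<-respʳ-≈ (+-comm y z) (+-monoˡ-< z x<y))

  +-cancelʳ-< : ∀ z {x y} → x + z < y + z → x < y
  +-cancelʳ-< z {x} {y} x+z<y+z =
    <-respˡ-≈ (x+y-y≈x x z) (<-respʳ-≈ (x+y-y≈x y z) (+-monoˡ-< (- z) x+z<y+z))

  *-distribˡ-- : ∀ z x y → z * (x - y) ≈ z * x - z * y
  *-distribˡ-- z x y = trans (distribˡ z x (- y)) (+-congˡ (sym (-‿distribʳ-* z y)))

  *-monoʳ-< : ∀ {z x y} → 0# < z → x < y → z * x < z * y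
  *-monoʳ-< {z} {x} {y} 0<z x<y =
    <-respˡ-≈ (+-identityˡ (z * x))
      (<-respʳ-≈ (x-y+y≈x (z * y) (z * x))
        (+-monoˡ-< (z * x)
          (<-respʳ-≈ (*-distribˡ-- z y x)
            (*-pos 0<z (<-respˡ-≈ (-‿inverseʳ x) (+-monoˡ-< (- x) x<y))))))

  -- The order is not assumed decidable, so x and y are first shown to be apart: z y - z x is
  -- invertible, hence so is y - x. Of the two resulting orderings, y < x contradicts monotonicity.
  *-cancelˡ-< : ∀ {z x y} → 0# < z → z * x < z * y → x < y
  *-cancelˡ-< {z} {x} {y} 0<z zx<zy with #⇒invertible (<⊎>⇒# (inj₂ zx<zy))
  ... | i , i*≈1 , _ with #⇒<⊎> {y} {x}
      (invertible⇒# (i * z , leftInverse , trans (*-comm (y - x) (i * z)) leftInverse))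
    where
    leftInverse : i * z * (y - x) ≈ 1#
    leftInverse = trans (*-assoc i z (y - x)) (trans (*-congˡ (*-distribˡ-- z y x)) i*≈1)
  ... | inj₁ y<x = contradiction (*-monoʳ-< 0<z y<x) (<-asym zx<zy)
  ... | inj₂ x<y = x<y

  fromℕ-mono-< : ∀ {a b} → a ℕ.< b → fromℕ a < fromℕ b
  fromℕ-mono-< {zero}  {suc b} _         = fromℕ-pos b
  fromℕ-mono-< {suc a} {suc b} (s≤s a<b) = +-monoʳ-< 1# (fromℕ-mono-< a<b)

  <-fromℕ-mono : ∀ {x a b} → x < fromℕ a → a ℕ.≤ b → x < fromℕ b
  <-fromℕ-mono x<a a≤b with ℕ.m≤n⇒m<n∨m≡n a≤b
  ... | inj₁ a<b    = <-trans x<a (fromℕ-mono-< a<b)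
  ... | inj₂ ≡.refl = x<a

  fromℕ-mono-≤ : ∀ {a b} → a ℕ.≤ b → fromℕ a ≤ fromℕ b
  fromℕ-mono-≤ a≤b b<a = <-irrefl refl (<-fromℕ-mono b<a a≤b)

  fromℕ-+ : ∀ a b → fromℕ (a ℕ.+ b) ≈ fromℕ a + fromℕ b
  fromℕ-+ = ×-homo-+ 1#

  fromℕ-* : ∀ a b → fromℕ (a ℕ.* b) ≈ fromℕ a * fromℕ b
  fromℕ-* = ×1-homo-*

  fromℕ-∑ : ∀ {k} (h : Fin k → ℕ) → ∑ᶠ (λ i → fromℕ (h i)) ≈ fromℕ (∑ h)
  fromℕ-∑ {zero}  h = refl
  fromℕ-∑ {suc k} h =
    trans (+-congˡ (fromℕ-∑ (λ i → h (suc i)))) (sym (fromℕ-+ (h zero) (∑ (λ i → h (suc i)))))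

  fromℕ-difference-≤ : ∀ a b c d → a ℕ.+ d ℕ.≤ c ℕ.+ b →
    fromℕ a - fromℕ b ≤ fromℕ c - fromℕ d
  fromℕ-difference-≤ a b c d a+d≤c+b c-d<a-b =
    fromℕ-mono-≤ a+d≤c+b
      (<-respˡ-≈ (cancel c d b) (<-respʳ-≈ (trans (+-congˡ (+-comm _ _)) (cancel a b d))
        (+-monoˡ-< (fromℕ d + fromℕ b) c-d<a-b)))
    where
    cancel : ∀ x y z → fromℕ x - fromℕ y + (fromℕ y + fromℕ z) ≈ fromℕ (x ℕ.+ z)
    cancel x y z = begin
      fromℕ x - fromℕ y + (fromℕ y + fromℕ z) ≈⟨ +-assoc _ _ _ ⟨
      fromℕ x - fromℕ y + fromℕ y + fromℕ z   ≈⟨ +-congʳ (x-y+y≈x _ _) ⟩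
      fromℕ x + fromℕ z                        ≈⟨ fromℕ-+ x z ⟨
      fromℕ (x ℕ.+ z)                          ∎

  x-0≈x : ∀ x → x - 0# ≈ x
  x-0≈x x = trans (sym (+-identityʳ (x - 0#))) (x-y+y≈x x 0#)

  archimedean-reciprocal : ∀ {x} → 0# < x → ∃[ n ] 1# < fromℕ (suc n) * x
  archimedean-reciprocal {x} 0<x with #⇒invertible (<⊎>⇒# (inj₂ 0<x))
  ... | i , _ , [x-0]i≈1 with archimedean i
  ...   | n , i<n = n , <-respˡ-≈ xi≈1 (<-respʳ-≈ (*-comm x (fromℕ (suc n)))
            (*-monoʳ-< 0<x (<-fromℕ-mono i<n (ℕ.n≤1+n n))))
    where
    xi≈1 : x * i ≈ 1#
    xi≈1 = trans (*-congʳ (sym (x-0≈x x))) [x-0]i≈1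

  3*4/3≈4 : fromℕ 3 * 4/3 ≈ fromℕ 4
  3*4/3≈4 with #⇒invertible {fromℕ 3} {0#} (<⊎>⇒# (inj₂ (fromℕ-pos 2)))
  ... | i , _ , [3-0]i≈1 = begin
    fromℕ 3 * (fromℕ 4 * i) ≈⟨ x∙yz≈y∙xz (fromℕ 3) (fromℕ 4) i ⟩
    fromℕ 4 * (fromℕ 3 * i) ≈⟨ *-congˡ (trans (*-congʳ (sym (x-0≈x (fromℕ 3)))) [3-0]i≈1) ⟩
    fromℕ 4 * 1#            ≈⟨ *-identityʳ (fromℕ 4) ⟩
    fromℕ 4                 ∎

  -- Scale by 3(E + 1): with α = 4/3 - ε, the number 4(E + 1)b splits into 3(E + 1)αb and 3b(E +
  -- 1)ε. The second summand exceeds 3b, the slack allowed by the hypothesis.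
  approximation-gap : ∀ {ε} E b n → 1# < fromℕ (suc E) * ε → 0 ℕ.< b →
    4 ℕ.* (suc E ℕ.* b) ℕ.≤ 3 ℕ.* (suc E ℕ.* n) ℕ.+ 3 ℕ.* b →
    (4/3 - ε) * fromℕ b < fromℕ n
  approximation-gap {ε} E b@(suc b₋₁) n 1<Eε _ 4Eb≤3En+3b =
    -- The witness is the predecessor of 3 (E + 1), which is how `3 ℕ.* suc E` unfolds.
    *-cancelˡ-< (fromℕ-pos (E ℕ.+ 2 ℕ.* suc E))
      (+-cancelʳ-< (fromℕ (3 ℕ.* b))
        (<-respʳ-≈ (trans (fromℕ-+ (3 ℕ.* (suc E ℕ.* n)) (3 ℕ.* b)) (+-congʳ 3En))
          (<-fromℕ-mono
            (<-respʳ-≈ 4Eb (+-monoʳ-< (fromℕ (3 ℕ.* suc E) * (α * fromℕ b)) 3b<3bEε))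
            4Eb≤3En+3b)))
    where
    α = 4/3 - ε
    3En : fromℕ (3 ℕ.* (suc E ℕ.* n)) ≈ fromℕ (3 ℕ.* suc E) * fromℕ n
    3En = trans (reflexive (≡.cong fromℕ (≡.sym (ℕ.*-assoc 3 (suc E) n)))) (fromℕ-* (3 ℕ.* suc E) n)
    3b<3bEε : fromℕ (3 ℕ.* b) < fromℕ (3 ℕ.* b) * (fromℕ (suc E) * ε)
    3b<3bEε = <-respˡ-≈ (*-identityʳ _) (*-monoʳ-< (fromℕ-pos (b₋₁ ℕ.+ 2 ℕ.* b)) 1<Eε)
    3α+3ε : fromℕ 3 * α + fromℕ 3 * ε ≈ fromℕ 4
    3α+3ε = trans (sym (distribˡ (fromℕ 3) α ε)) (trans (*-congˡ (x-y+y≈x 4/3 ε)) 3*4/3≈4)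
    regroup : ∀ x → fromℕ (3 ℕ.* suc E ℕ.* b) * x ≈ fromℕ (suc E ℕ.* b) * (fromℕ 3 * x)
    regroup x = begin
      fromℕ (3 ℕ.* suc E ℕ.* b) * x ≈⟨ *-congʳ (reflexive (≡.cong fromℕ
          (≡.trans (ℕ.*-assoc 3 (suc E) b) (ℕ.*-comm 3 (suc E ℕ.* b))))) ⟩
      fromℕ (suc E ℕ.* b ℕ.* 3) * x ≈⟨ *-congʳ (fromℕ-* (suc E ℕ.* b) 3) ⟩
      fromℕ (suc E ℕ.* b) * fromℕ 3 * x ≈⟨ *-assoc _ _ _ ⟩
      fromℕ (suc E ℕ.* b) * (fromℕ 3 * x) ∎
    3Eαb : fromℕ (3 ℕ.* suc E) * (α * fromℕ b) ≈ fromℕ (3 ℕ.* suc E ℕ.* b) * α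
    3Eαb = trans (x∙yz≈xz∙y _ _ _) (*-congʳ (sym (fromℕ-* (3 ℕ.* suc E) b)))
    3bEε : fromℕ (3 ℕ.* b) * (fromℕ (suc E) * ε) ≈ fromℕ (3 ℕ.* suc E ℕ.* b) * ε
    3bEε = trans (sym (*-assoc _ _ _))
      (*-congʳ (trans (sym (fromℕ-* (3 ℕ.* b) (suc E)))
        (reflexive (≡.cong fromℕ (commute E b)))))
      where
      commute : ∀ e b → 3 ℕ.* b ℕ.* suc e ≡ 3 ℕ.* suc e ℕ.* b
      commute = solve-∀
    4Eb : fromℕ (3 ℕ.* suc E) * (α * fromℕ b) + fromℕ (3 ℕ.* b) * (fromℕ (suc E) * ε)
          ≈ fromℕ (4 ℕ.* (suc E ℕ.* b))
    4Eb = begin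
      fromℕ (3 ℕ.* suc E) * (α * fromℕ b) + fromℕ (3 ℕ.* b) * (fromℕ (suc E) * ε)
        ≈⟨ +-cong (trans 3Eαb (regroup α)) (trans 3bEε (regroup ε)) ⟩
      fromℕ (suc E ℕ.* b) * (fromℕ 3 * α) + fromℕ (suc E ℕ.* b) * (fromℕ 3 * ε)
        ≈⟨ distribˡ _ _ _ ⟨
      fromℕ (suc E ℕ.* b) * (fromℕ 3 * α + fromℕ 3 * ε)
        ≈⟨ *-congˡ 3α+3ε ⟩
      fromℕ (suc E ℕ.* b) * fromℕ 4
        ≈⟨ fromℕ-* (suc E ℕ.* b) 4 ⟨
      fromℕ (suc E ℕ.* b ℕ.* 4)
        ≈⟨ reflexive (≡.cong fromℕ (ℕ.*-comm (suc E ℕ.* b) 4)) ⟩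
      fromℕ (4 ℕ.* (suc E ℕ.* b)) ∎

  -- With 1 < P p, probability at least p means at least one P-th of the seeds.
  probability-bound : ∀ {p} P N g → 1# < fromℕ (suc P) * p →
    p * fromℕ N ≤ fromℕ g → N ℕ.≤ suc P ℕ.* g
  probability-bound {p} P zero        g _    _    = z≤n
  probability-bound {p} P N@(suc N₋₁) g 1<Pp pN≤g with N ℕ.≤? suc P ℕ.* g
  ... | yes N≤Pg = N≤Pg
  ... | no  N≰Pg = contradiction g<pN pN≤g
    where
    N<PpN : fromℕ N < fromℕ (suc P) * (p * fromℕ N)
    N<PpN = <-respˡ-≈ (*-identityʳ _) (<-respʳ-≈
      (trans (*-comm _ _) (*-assoc _ _ _)) (*-monoʳ-< (fromℕ-pos N₋₁) 1<Pp))
    g<pN : fromℕ g < p * fromℕ N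
    g<pN = *-cancelˡ-< (fromℕ-pos P)
      (<-trans (<-respˡ-≈ (fromℕ-* (suc P) g) (fromℕ-mono-< (ℕ.≰⇒> N≰Pg))) N<PpN)

-- Runs of strategies on planted instances, and averaging over seeds.

module Hardness {c ℓ₁ ℓ₂ ℓ₃} (ℝ : ArchimedeanOrderedField c ℓ₁ ℓ₂ ℓ₃) where

  open Combinatorics
  open import Relation.Binary.PropositionalEquality
  open ArchimedeanOrderedField ℝ
    using (_<_; _≤_; _*_; _-_; 1#; 4/3; fromℕ; _≈_; *-congˡ)
    renaming (sym to ≈-sym; reflexive to ≈-reflexive; trans to ≈-trans)
  open OrderedFieldProperties ℝ
  open RandomizedStrategy using (seeds; strategy)

  seeds-pos : ∀ {n k} (ρ : RandomizedStrategy ℝ n k) → 0 ℕ.< seeds ρ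
  seeds-pos record { seeds = N ; seedsNonZero = N≢0 } = ℕ.>-nonZero⁻¹ N {{N≢0}}

  hiddenInstance : ∀ {n} → ℕ → ℕ → Subset n → MonSub ℝ n
  hiddenInstance m β R = record
    { f           = λ A → fromℕ (hidden m β R A)
    ; nonNegative = λ A → fromℕ-mono-≤ {0} {hidden m β R A} z≤n
    ; monotone    = λ A B A⊆B → fromℕ-mono-≤ (hidden-mono m β R A⊆B)
    ; submodular  = λ A B v A⊆B v∉B →
        fromℕ-difference-≤ (hidden m β R (B ∪ ⁅ v ⁆)) (hidden m β R B)
          (hidden m β R (A ∪ ⁅ v ⁆)) (hidden m β R A) (hidden-submodular m β R A⊆B v∉B)
    }

  -- The sets whose values determine a run and the cost of its output.
  trace : ∀ {n k} → Strategy ℝ n k → SetFunction ℝ n → List (Subset n)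
  trace (output S)     f = tabulate S
  trace (query A next) f = A ∷ trace (next (f A)) f

  length-trace : ∀ {n k} (σ : Strategy ℝ n k) f → length (trace σ f) ≡ queries ℝ σ f ℕ.+ k
  length-trace (output S)     f = length-tabulate S
  length-trace (query A next) f = cong suc (length-trace (next (f A)) f)

  -- Equal answers lead to the same next query, so the run on `g` never leaves the run on `f`. A
  -- continuation need not respect `_≈_`, hence the agreement is `_≡_`; planted instances provide it
  -- because their values are `fromℕ` of natural numbers.
  result-local : ∀ {n k} (σ : Strategy ℝ n k) f g →
    All (λ A → g A ≡ f A) (trace σ f) → result ℝ σ g ≡ result ℝ σ f
  result-local (output S)     f g _               = refl
  result-local (query A next) f g (gA≡fA ∷ g≡f) rewrite gA≡fA = result-local (next (f A)) f g g≡f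

  trace-result : ∀ {n k p} {P : Subset n → Set p} (σ : Strategy ℝ n k) f →
    All P (trace σ f) → ∀ i → P (result ℝ σ f i)
  trace-result (output S)     f Ps       = All.tabulate⁻ Ps
  trace-result (query A next) f (_ ∷ Ps) = trace-result (next (f A)) f Ps

  hidden-partition-isPartition : ∀ {n} (R : Subset n) → Nonempty R → IsPartition ℝ (hidden-partition R)
  hidden-partition-isPartition {n} R R≠∅ = record
    { disjoint = disjoint ; covers = covers ; nonempty = nonempty }
    where
    disjoint : ∀ i j → i ≢ j → ¬ Nonempty (hidden-partition R i ∩ hidden-partition R j)
    disjoint i j i≢j (v , v∈∩) with i | j | x∈p∩q⁻ (hidden-partition R i) (hidden-partition R j) v∈∩
    ... | zero  | zero  | _         = i≢j refl
    ... | zero  | suc j | v∈R , v∈j = singletons-∉ R j v∈R v∈j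
    ... | suc i | zero  | v∈i , v∈R = singletons-∉ R i v∈R v∈i
    ... | suc i | suc j | v∈i , v∈j = i≢j (cong suc (singletons-disjoint R i j v∈i v∈j))
    covers : ∀ v → ∃[ i ] v ∈ hidden-partition R i
    covers v with singletons-cover R v
    ... | inj₁ v∈R       = zero , v∈R
    ... | inj₂ (i , v∈i) = suc i , v∈i
    nonempty : ∀ i → Nonempty (hidden-partition R i)
    nonempty zero    = R≠∅
    nonempty (suc i) = singletons-nonempty R i

  cost-hidden : ∀ {n k} m β R (S : Fin k → Subset n) →
    cost ℝ (MonSub.f (hiddenInstance m β R)) S ≈ fromℕ (∑ (λ i → hidden m β R (S i)))
  cost-hidden m β R S = fromℕ-∑ (λ i → hidden m β R (S i))

  -- `IsApproximation` compares only with optimal partitions, so one has to be exhibited for it to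
  -- have content. The cost of `hidden-partition` meets the lower bound of `partition-cost`.
  hidden-partition-optimal : ∀ {n m β c} (R : Subset n) → 0 ℕ.< β → β ℕ.≤ m → m ℕ.+ c ≡ n →
    ∣ R ∣ ≡ m → ∣ ∁ R ∣ ≡ c →
    Σ[ T ∈ (Fin (suc c) → Subset n) ] IsOptimal ℝ (MonSub.f (hiddenInstance m β R)) T ×
      ∑ (λ i → hidden m β R (T i)) ≡ β ℕ.+ c
  hidden-partition-optimal {n} {m} {β} R 0<β β≤m m+c≡n refl refl =
    hidden-partition R , record { isPartition = isPartition ; minimal = minimal } ,
    ℕ.≤-antisym cost≤ (lower (hidden-partition R) isPartition)
    where
    isPartition = hidden-partition-isPartition R (0<∣p∣⇒Nonempty R (ℕ.≤-trans 0<β β≤m))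
    cost≤ = hidden-partition-cost m β R
    lower : ∀ T → IsPartition ℝ T → β ℕ.+ ∣ ∁ R ∣ ℕ.≤ ∑ (λ i → hidden m β R (T i))
    lower T T-partition = partition-cost m β R 0<β β≤m
      (ℕ.≤-trans (ℕ.+-monoˡ-≤ ∣ ∁ R ∣ β≤m) (ℕ.≤-reflexive m+c≡n)) T
      (IsPartition.covers T-partition) (IsPartition.nonempty T-partition)
    minimal : ∀ T → IsPartition ℝ T → cost ℝ (MonSub.f (hiddenInstance m β R)) (hidden-partition R) ≤
                                      cost ℝ (MonSub.f (hiddenInstance m β R)) T
    minimal T T-partition cost< = fromℕ-mono-≤ (ℕ.≤-trans cost≤ (lower T T-partition))
      (<-respˡ-≈ (cost-hidden m β R T) (<-respʳ-≈ (cost-hidden m β R (hidden-partition R)) cost<))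

  module _ {ε E n} (1<Eε : 1# < fromℕ (suc E) * ε) (π : Parameters E n) where
    open Parameters π

    private
      m = ⌊ n /2⌋
      k : ℕ
      k = suc ⌈ n /2⌉
      f₀ : SetFunction ℝ n
      f₀ = MonSub.f (hiddenInstance m m ⊥)
      fR : Subset n → SetFunction ℝ n
      fR R = MonSub.f (hiddenInstance m β R)

    -- Undetected parts are charged as by f₀, hence at least n in total, whereas the planted optimum
    -- is β + ⌈n/2⌉; `gap` puts these further apart than the factor 4/3 - ε.
    undetected⇒not-approximation : ∀ {R} → Halving R → (S : Fin k → Subset n) →
      (∀ i → hidden m β R (S i) ≡ hidden m m ⊥ (S i)) → ¬ IsApproximation ℝ (4/3 - ε) (fR R) S
    undetected⇒not-approximation {R} (∣R∣≡m , ∣∁R∣≡c) S undetected (S-partition , approximates)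
      with hidden-partition-optimal R 0<β β≤m (ℕ.⌊n/2⌋+⌈n/2⌉≡n n) ∣R∣≡m ∣∁R∣≡c
    ... | T , T-optimal , cost-T = approximates T T-optimal
      (<-respˡ-≈ (*-congˡ (≈-sym (≈-trans (cost-hidden m β R T) (≈-reflexive (cong fromℕ cost-T)))))
        (<-respʳ-≈ (≈-sym (cost-hidden m β R S))
          (<-fromℕ-mono
            (approximation-gap E (β ℕ.+ ⌈ n /2⌉) n 1<Eε (ℕ.≤-trans 0<β (ℕ.m≤m+n β _)) gap)
            n≤cost-S)))
      where
      open ℕ.≤-Reasoning
      n≤cost-S : n ℕ.≤ ∑ (λ i → hidden m β R (S i))
      n≤cost-S = begin
        n                                     ≡⟨ ℕ.⌊n/2⌋+⌈n/2⌉≡n n ⟨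
        m ℕ.+ ⌈ n /2⌉                         ≤⟨ partition-cost m m ⊥ (ℕ.≤-trans 0<β β≤m) ℕ.≤-refl
            (ℕ.≤-reflexive (ℕ.⌊n/2⌋+⌈n/2⌉≡n n)) S
            (IsPartition.covers S-partition) (IsPartition.nonempty S-partition) ⟩
        ∑ (λ i → hidden m m ⊥ (S i))          ≡⟨ sum-cong-≗ undetected ⟨
        ∑ (λ i → hidden m β R (S i))          ∎

    -- By contradiction: if no set in the trace on f₀ detects R, the run on f_R coincides with the
    -- run on f₀ and its output parts are undetected.
    approximation⇒detections : ∀ {R} → Halving R → (σ : Strategy ℝ n k) →
      IsApproximation ℝ (4/3 - ε) (fR R) (result ℝ σ (fR R)) → 0 ℕ.< detections β (trace σ f₀) R
    approximation⇒detections {R} R-halving σ approx = ℕ.n≢0⇒n>0 λ none →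
      let same : All (λ A → hidden m β R A ≡ hidden m m ⊥ A) (trace σ f₀)
          same = All.map (λ {A} → detection≡0⇒≡ m β R A)
            (sum-map≡0⇒≡0 (detection m β R) (trace σ f₀) none)
      in undetected⇒not-approximation R-halving (result ℝ σ f₀) (trace-result σ f₀ same)
        (subst (IsApproximation ℝ (4/3 - ε) (fR R))
          (result-local σ f₀ (fR R) (All.map (λ {A} → cong fromℕ {hidden m β R A}) same)) approx)

    -- The good seeds vary with R, but the trace of a seed on f₀ does not. For each R the detections
    -- summed over the seeds are at least a 1/(P + 1) share of their number; exchanging this sum
    -- with the one over R, some seed reaches the average.
    some-seed-detects : ∀ {p P} (𝒜 : Algorithm ℝ) → 1# < fromℕ (suc P) * p → k ℕ.≤ n →
      Achieves ℝ 𝒜 (4/3 - ε) p →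
      ∃[ s ] 2 ^ m ℕ.≤ sum (map (detections β (trace (strategy (𝒜 n k) s) f₀)) (transversals n)) ℕ.* suc P
    some-seed-detects {p} {P} 𝒜 1<Pp k≤n achieves =
      pigeonhole (seeds (𝒜 n k)) (seeds-pos (𝒜 n k)) h counting
      where
      N = seeds (𝒜 n k)
      As : Fin N → List (Subset n)
      As s = trace (strategy (𝒜 n k) s) f₀
      h : Fin N → ℕ
      h s = sum (map (detections β (As s)) (transversals n)) ℕ.* suc P
      open ℕ.≤-Reasoning
      per-R : ∀ {R} → Halving R → N ℕ.≤ ∑ (λ s → detections β (As s) R) ℕ.* suc P
      per-R {R} R-halving with achieves n k (s≤s z≤n) k≤n (hiddenInstance m β R)
      ... | G , pN≤∣G∣ , good = begin
        N                   ≤⟨ probability-bound P N ∣ G ∣ 1<Pp pN≤∣G∣ ⟩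
        suc P ℕ.* ∣ G ∣     ≡⟨ ℕ.*-comm (suc P) ∣ G ∣ ⟩
        ∣ G ∣ ℕ.* suc P     ≤⟨ ℕ.*-monoˡ-≤ (suc P) (∣p∣≤∑ G _ λ s s∈G →
                                 approximation⇒detections R-halving (strategy (𝒜 n k) s) (good s s∈G)) ⟩
        ∑ (λ s → detections β (As s) R) ℕ.* suc P ∎
      counting : N ℕ.* 2 ^ m ℕ.≤ ∑ h
      counting = begin
        N ℕ.* 2 ^ m                                   ≡⟨ ℕ.*-comm N (2 ^ m) ⟩
        2 ^ m ℕ.* N                                   ≡⟨ cong (ℕ._* N) (length-transversals n) ⟨
        length (transversals n) ℕ.* N                 ≡⟨ sum-map-const N (transversals n) ⟨
        sum (map (λ _ → N) (transversals n))
          ≤⟨ sum-map-mono (All.map per-R (transversals-halving n)) ⟩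
        sum (map (λ R → ∑ (λ s → detections β (As s) R) ℕ.* suc P) (transversals n))
          ≡⟨ sum-map-*ʳ (λ R → ∑ (λ s → detections β (As s) R)) (suc P) (transversals n) ⟩
        sum (map (λ R → ∑ (λ s → detections β (As s) R)) (transversals n)) ℕ.* suc P
          ≡⟨ cong (ℕ._* suc P) (sum-map-∑ (λ R s → detections β (As s) R) (transversals n)) ⟩
        ∑ (λ s → sum (map (detections β (As s)) (transversals n))) ℕ.* suc P
          ≡⟨ SemiringSum.*-distribʳ-sum ℕ.+-*-semiring (suc P)
               (λ s → sum (map (detections β (As s)) (transversals n))) ⟩
        ∑ h ∎
      pigeonhole : ∀ N → 0 ℕ.< N → (h : Fin N → ℕ) → N ℕ.* 2 ^ m ℕ.≤ ∑ h → ∃[ s ] 2 ^ m ℕ.≤ h s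
      pigeonhole (suc N) _ h = pigeonhole-∑ N h (2 ^ m)

theorem2 : ∀ {c ℓ₁ ℓ₂ ℓ₃} (ℝ : ArchimedeanOrderedField c ℓ₁ ℓ₂ ℓ₃) →
    let open ArchimedeanOrderedField ℝ in
    ∀ (ε p : Carrier) → 0# < ε → 0# < p →
    ∃[ d ] ∃[ n₀ ] ∀ (𝒜 : Algorithm ℝ) →
    Achieves ℝ 𝒜 (4/3 - ε) p → ExponentiallyManyQueries ℝ 𝒜 d n₀
theorem2 ℝ ε p 0<ε 0<p
  with OrderedFieldProperties.archimedean-reciprocal ℝ 0<ε
     | OrderedFieldProperties.archimedean-reciprocal ℝ 0<p
... | E , 1<Eε | P , 1<Pp = exponent , n₁ ℕ.+ (D ℕ.+ D) , lower-bound
  where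
  open Combinatorics
  open Hardness ℝ
  open ArchimedeanOrderedField ℝ using (4/3; _-_)
  D = 4 ℕ.* suc E
  -- The factor 2D turns the base 1 + 1/(2D) into 2, 3D passes from `t` to n, and the outer 2 pays
  -- for the polynomial factor. The threshold adds 2D to `n₁` so that D ≤ ⌊n/2⌋ holds as well.
  exponent = 2 ℕ.* (2 ℕ.* D ℕ.* (3 ℕ.* D))
  growth = power≤exponential (2 ℕ.* suc P) exponent
  n₁ = proj₁ growth
  lower-bound : ∀ 𝒜 → Achieves ℝ 𝒜 (4/3 - ε) p → ExponentiallyManyQueries ℝ 𝒜 exponent (n₁ ℕ.+ (D ℕ.+ D))
  lower-bound 𝒜 achieves n n₀≤n =
    -- The instance with the long run is f₀ itself, where nothing is planted.
    q , (k , s≤s z≤n , k≤n , hiddenInstance m m ⊥ , s , ≡.refl) ,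
    exponential-in-n D (suc P) n {{ℕ.>-nonZero (ℕ.≤-trans (s≤s z≤n) k≤n)}} t q n≤3Dt 2^t≤
      (proj₂ growth n (ℕ.m+n≤o⇒m≤o n₁ n₀≤n))
    where
    m = ⌊ n /2⌋
    k : ℕ
    k = suc ⌈ n /2⌉
    D≤m : D ℕ.≤ m
    D≤m = ℕ.≤-trans (ℕ.≤-reflexive (ℕ.n≡⌊n+n/2⌋ D)) (ℕ.⌊n/2⌋-mono (ℕ.m+n≤o⇒n≤o n₁ n₀≤n))
    k≤n : k ℕ.≤ n
    k≤n = ℕ.≤-trans (ℕ.+-monoˡ-≤ ⌈ n /2⌉ (ℕ.≤-trans (s≤s z≤n) D≤m)) (ℕ.≤-reflexive (ℕ.⌊n/2⌋+⌈n/2⌉≡n n))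
    π = parameters E n D≤m
    open Parameters π
    found = some-seed-detects 1<Eε π 𝒜 1<Pp k≤n achieves
    s = proj₁ found
    σ = RandomizedStrategy.strategy (𝒜 n k) s
    f₀ = MonSub.f (hiddenInstance m m ⊥)
    q = queries ℝ σ f₀
    2^t≤ : 2 ^ t ℕ.≤ (suc P ℕ.* (q ℕ.+ n)) ^ (2 ℕ.* D)
    -- Besides the q queries the trace holds the k output parts, and k ≤ n.
    2^t≤ = ℕ.≤-trans
      (detecting-needs-many-sets D β t (suc P) (trace σ f₀) m+t≤2β m≤Dt (proj₂ found))
      (ℕ.^-monoˡ-≤ (2 ℕ.* D) (ℕ.*-monoʳ-≤ (suc P)
        (ℕ.≤-trans (ℕ.≤-reflexive (length-trace σ f₀)) (ℕ.+-monoʳ-≤ q k≤n))))
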